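{- Let $A \in \mathbb{R}^{m \times n_A}$ and $B \in \mathbb{R}^{m \times n_B}$, where the columns of $B$ are nonzero. Let $k \le n_B$ and let $OPT_k$ be a set of $k$ columns of $B$ maximizing $f_A(S)$ over all sets $S$ of $k$ columns of $B$, and assume $\sigma_{\min}(OPT_k) > 0$. Let $\varepsilon > 0$, and let $T_r$ be the set of columns output by $\textsc{Greedy}(A, B, r)$ for $r = \left\lceil \frac{16k}{\varepsilon\, \sigma_{\min}(OPT_k)} \right\rceil$. Then $$f_A(T_r) \ge (1-\varepsilon)\, f_A(OPT_k).$$
   Context: For a finite set $V$ of vectors in $\mathbb{R}^m$, $\Pi_V$ denotes the orthogonal projector onto $\mathrm{span}(V)$. For a matrix $M$ with $m$ rows, $f_M(V) = \|\Pi_V M\|_F^2$ (the squared Frobenius norm of the projection of $M$ onto $\mathrm{span}(V)$). For a finite set $V$ of nonzero vectors, $\sigma_{\min}(V)$ is the smallest squared singular value of the matrix whose columns are the vectors of $V$ rescaled to unit length, i.e. $\inf_{\|x\|_2=1}\|Mx\|_2^2$ for that matrix $M$. The algorithm $\textsc{Greedy}(A, B, r)$: start with $S = \emptyset$; for $i = 1, \dots, r$, pick a column $B_j$ of $B$ maximizing $f_A(S \cup \{B_j\})$ and set $S \leftarrow S \cup \{B_j\}$; return $S$. -}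

module Defs where

open import Algebra.Bundles using (CommutativeRing)
open import Algebra.Core using (Op₁; Op₂)
open import Data.Bool.Base using (true; false)
open import Data.Fin.Base using (Fin; zero; suc)
open import Data.Fin.Subset using (Subset; ∣_∣; ⊥; ⁅_⁆; _∪_)
open import Data.Nat.Base as ℕ using (ℕ)
open import Data.Product.Base using (∃; ∃-syntax; _×_; _,_; proj₁; proj₂)
open import Data.Sum.Base using (inj₁; inj₂)
open import Data.Vec.Base using ([]; _∷_)
open import Data.Vec.Functional using (Vector)
open import Function.Base using (_∘_)
open import Level using (_⊔_)
open import Relation.Binary.Core using (Rel)
open import Relation.Binary.PropositionalEquality.Core using (_≡_)
open import Relation.Binary.Structures using (IsDecTotalOrder)
open import Relation.Nullary using (¬_; yes; no)
open import Relation.Unary using (Pred)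

-- The real numbers, axiomatised as a Dedekind-complete ordered field, which
-- determines them up to unique isomorphism.  The axiomatisation is classical:
-- equality and order are decidable.  The inverse is total, with an unspecified
-- value at 0.

record Reals c ℓ : Set (Level.suc (c ⊔ ℓ)) where
  field
    commutativeRing : CommutativeRing c ℓ

  open CommutativeRing commutativeRing public hiding (zero)

  infix  4 _≤_ _<_
  infix  8 _⁻¹
  infixl 7 _/_

  field
    _≤_             : Rel Carrier ℓ
    isDecTotalOrder : IsDecTotalOrder _≈_ _≤_
    0≉1             : 0# ≉ 1#
    _⁻¹             : Op₁ Carrier
    ⁻¹-cong         : ∀ {x y} → x ≈ y → x ⁻¹ ≈ y ⁻¹
    ⁻¹-inverseʳ     : ∀ {x} → x ≉ 0# → x * x ⁻¹ ≈ 1#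
    +-monoˡ-≤       : ∀ z {x y} → x ≤ y → x + z ≤ y + z
    *-nonneg        : ∀ {x y} → 0# ≤ x → 0# ≤ y → 0# ≤ x * y

  UpperBound : Pred Carrier (c ⊔ ℓ) → Pred Carrier (c ⊔ ℓ)
  UpperBound S b = ∀ x → S x → x ≤ b

  LowerBound : Pred Carrier (c ⊔ ℓ) → Pred Carrier (c ⊔ ℓ)
  LowerBound S b = ∀ x → S x → b ≤ x

  IsSupremum : Pred Carrier (c ⊔ ℓ) → Pred Carrier (c ⊔ ℓ)
  IsSupremum S s = UpperBound S s × (∀ b → UpperBound S b → s ≤ b)

  IsInfimum : Pred Carrier (c ⊔ ℓ) → Pred Carrier (c ⊔ ℓ)
  IsInfimum S s = LowerBound S s × (∀ b → LowerBound S b → b ≤ s)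

  field
    complete : ∀ (S : Pred Carrier (c ⊔ ℓ)) → ∃ S → ∃ (UpperBound S) →
               ∃ (IsSupremum S)

  module Order = IsDecTotalOrder isDecTotalOrder

  _<_ : Rel Carrier ℓ
  x < y = x ≤ y × x ≉ y

  _/_ : Op₂ Carrier
  x / y = x * y ⁻¹

  open import Algebra.Properties.Semiring.Mult semiring using ()
    renaming (_×_ to _·ℕ_)

  fromℕ : ℕ → Carrier
  fromℕ n = n ·ℕ 1#

  IsCeiling : Carrier → ℕ → Set ℓ
  IsCeiling x n = x ≤ fromℕ n × fromℕ n < x + 1#

module LinearAlgebra {c ℓ} (ℝ : Reals c ℓ) where
  open Reals ℝ public
  open import Algebra.Properties.Semiring.Sum semiring
  open import Data.Vec.Functional.Relation.Binary.Equality.Setoid setoid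
    using (_≋_)

  Matrix : ℕ → ℕ → Set c
  Matrix m n = Fin m → Fin n → Carrier

  column : ∀ {m n} → Matrix m n → Fin n → Vector Carrier m
  column M j i = M i j

  infix  4 _≋ᴹ_
  infixr 7 _*ᵛ_ _*ᴹ_
  infix  8 _ᵀ
  infix  9 _↾_

  _≋ᴹ_ : ∀ {m n} → Rel (Matrix m n) ℓ
  M ≋ᴹ N = ∀ i j → M i j ≈ N i j

  0ᵛ : ∀ {m} → Vector Carrier m
  0ᵛ _ = 0#

  NonZero : ∀ {m} → Pred (Vector Carrier m) ℓ
  NonZero x = ¬ (x ≋ 0ᵛ)

  ‖_‖² : ∀ {m} → Vector Carrier m → Carrier
  ‖ x ‖² = sum (λ i → x i * x i)

  ‖_‖F² : ∀ {m n} → Matrix m n → Carrier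
  ‖ M ‖F² = sum (λ i → sum (λ j → M i j * M i j))

  _ᵀ : ∀ {m n} → Matrix m n → Matrix n m
  (M ᵀ) i j = M j i

  _*ᵛ_ : ∀ {m n} → Matrix m n → Vector Carrier n → Vector Carrier m
  (M *ᵛ x) i = sum (λ j → M i j * x j)

  _*ᴹ_ : ∀ {m n p} → Matrix m n → Matrix n p → Matrix m p
  (M *ᴹ N) i k = sum (λ j → M i j * N j k)

  -- A finite set of vectors is given by the columns of a matrix V.

  Span : ∀ {m k} → Matrix m k → Pred (Vector Carrier m) (c ⊔ ℓ)
  Span V x = ∃[ a ] V *ᵛ a ≋ x

  record IsOrthogonalProjector {m k} (V : Matrix m k) (P : Matrix m m) :
         Set (c ⊔ ℓ) where
    field
      symmetric  : P ᵀ ≋ᴹ P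
      idempotent : P *ᴹ P ≋ᴹ P
      range⊆span : ∀ x → Span V (P *ᵛ x)
      span⊆range : ∀ y → Span V y → ∃[ x ] P *ᵛ x ≋ y

  -- The orthogonal projector exists, by Gram–Schmidt.  Its defining properties
  -- determine it up to ≋ᴹ, so nothing depends on the choice made here.

  private
    module GramSchmidt where
      open import Relation.Binary.Reasoning.Setoid setoid
      open import Algebra.Properties.Ring ring
        using (-‿distribˡ-*; -‿distribʳ-*; -‿involutive; x∙y⁻¹≈ε⇒x≈y)
      open import Algebra.Properties.CommutativeSemigroup
        +-commutativeSemigroup using (x∙yz≈y∙xz)
      open import Algebra.Properties.CommutativeSemigroup
        *-commutativeSemigroup using (xy∙z≈xz∙y)

      neg*neg : ∀ x → - x * - x ≈ x * x
      neg*neg x = begin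
        - x * - x     ≈⟨ -‿distribˡ-* x (- x) ⟨
        - (x * - x)   ≈⟨ -‿cong (-‿distribʳ-* x x) ⟨
        - (- (x * x)) ≈⟨ -‿involutive (x * x) ⟩
        x * x         ∎

      sq-nonneg : ∀ x → 0# ≤ x * x
      sq-nonneg x with Order.total 0# x
      ... | inj₁ 0≤x = *-nonneg 0≤x 0≤x
      ... | inj₂ x≤0 = Order.≤-respʳ-≈ (neg*neg x) (*-nonneg 0≤-x 0≤-x)
        where
        0≤-x : 0# ≤ - x
        0≤-x = Order.≤-respˡ-≈ (-‿inverseʳ x)
                 (Order.≤-respʳ-≈ (+-identityˡ (- x)) (+-monoˡ-≤ (- x) x≤0))

      sq-zero : ∀ x → x * x ≈ 0# → x ≈ 0#
      sq-zero x xx≈0 with x Order.≟ 0#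
      ... | yes x≈0 = x≈0
      ... | no  x≉0 = begin
        x              ≈⟨ *-identityʳ x ⟨
        x * 1#         ≈⟨ *-congˡ (⁻¹-inverseʳ x≉0) ⟨
        x * (x * x ⁻¹) ≈⟨ *-assoc x x (x ⁻¹) ⟨
        x * x * x ⁻¹   ≈⟨ *-congʳ xx≈0 ⟩
        0# * x ⁻¹      ≈⟨ zeroˡ _ ⟩
        0#             ∎

      x≤x+y : ∀ x {y} → 0# ≤ y → x ≤ x + y
      x≤x+y x {y} 0≤y = Order.≤-respˡ-≈ (+-identityˡ x)
        (Order.≤-respʳ-≈ (+-comm y x) (+-monoˡ-≤ x 0≤y))

      ‖‖²-nonneg : ∀ {m} (x : Vector Carrier m) → 0# ≤ ‖ x ‖²
      ‖‖²-nonneg {ℕ.zero}  x = Order.refl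
      ‖‖²-nonneg {ℕ.suc m} x =
        Order.trans (sq-nonneg (x zero)) (x≤x+y _ (‖‖²-nonneg (x ∘ suc)))

      ‖‖²-zero : ∀ {m} (x : Vector Carrier m) → ‖ x ‖² ≈ 0# → x ≋ 0ᵛ
      ‖‖²-zero {ℕ.suc m} x eq zero = sq-zero _ (Order.antisym
        (Order.≤-respʳ-≈ eq (x≤x+y _ (‖‖²-nonneg (x ∘ suc))))
        (sq-nonneg (x zero)))
      ‖‖²-zero {ℕ.suc m} x eq (suc i) = ‖‖²-zero (x ∘ suc) (Order.antisym
        (Order.≤-respʳ-≈ (trans (+-comm _ _) eq)
          (x≤x+y _ (sq-nonneg (x zero))))
        (‖‖²-nonneg (x ∘ suc))) i

      infix 8 _·_
      _·_ : ∀ {m} → Vector Carrier m → Vector Carrier m → Carrier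
      x · y = sum (λ i → x i * y i)

      ·-congʳ : ∀ {m} {x x′ : Vector Carrier m} y → x ≋ x′ → x · y ≈ x′ · y
      ·-congʳ y e = sum-cong-≋ (λ i → *-congʳ (e i))

      ·-congˡ : ∀ {m} x {y y′ : Vector Carrier m} → y ≋ y′ → x · y ≈ x · y′
      ·-congˡ x e = sum-cong-≋ (λ i → *-congˡ (e i))

      ·-comm : ∀ {m} (x y : Vector Carrier m) → x · y ≈ y · x
      ·-comm x y = sum-cong-≋ (λ i → *-comm (x i) (y i))

      ·-axpy : ∀ {m} (x : Vector Carrier m) s (z y : Vector Carrier m) →
               (λ i → x i + s * z i) · y ≈ x · y + s * z · y
      ·-axpy x s z y = begin
        sum (λ i → (x i + s * z i) * y i)
          ≈⟨ sum-cong-≋ (λ i → trans (distribʳ (y i) (x i) (s * z i))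
               (+-congˡ (*-assoc s (z i) (y i)))) ⟩
        sum (λ i → x i * y i + s * (z i * y i))
          ≈⟨ ∑-distrib-+ (λ i → x i * y i) (λ i → s * (z i * y i)) ⟩
        x · y + sum (λ i → s * (z i * y i))
          ≈⟨ +-congˡ (*-distribˡ-sum s (λ i → z i * y i)) ⟨
        x · y + s * z · y ∎

      *ᵛ-assoc : ∀ {m n p} (M : Matrix m n) (N : Matrix n p) a →
                 M *ᵛ N *ᵛ a ≋ (M *ᴹ N) *ᵛ a
      *ᵛ-assoc M N a i = begin
        sum (λ k → M i k * sum (λ j → N k j * a j))
          ≈⟨ sum-cong-≋ (λ k → trans (*-distribˡ-sum (M i k) (λ j → N k j * a j))
               (sum-cong-≋ (λ j → sym (*-assoc (M i k) (N k j) (a j))))) ⟩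
        sum (λ k → sum (λ j → M i k * N k j * a j))
          ≈⟨ ∑-comm (λ k j → M i k * N k j * a j) ⟩
        sum (λ j → sum (λ k → M i k * N k j * a j))
          ≈⟨ sum-cong-≋ (λ j → *-distribʳ-sum (a j) (λ k → M i k * N k j)) ⟨
        sum (λ j → sum (λ k → M i k * N k j) * a j) ∎

      adjoint : ∀ {m} (P : Matrix m m) → P ᵀ ≋ᴹ P → ∀ x y →
                (P *ᵛ x) · y ≈ x · (P *ᵛ y)
      adjoint P P-sym x y = begin
        sum (λ i → sum (λ j → P i j * x j) * y i)
          ≈⟨ sum-cong-≋ (λ i → *-distribʳ-sum (y i) (λ j → P i j * x j)) ⟩
        sum (λ i → sum (λ j → P i j * x j * y i))
          ≈⟨ ∑-comm (λ i j → P i j * x j * y i) ⟩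
        sum (λ j → sum (λ i → P i j * x j * y i))
          ≈⟨ sum-cong-≋ (λ j → sum-cong-≋ (λ i → trans
               (*-congʳ (trans (*-comm (P i j) (x j)) (*-congˡ (P-sym j i))))
               (*-assoc (x j) (P j i) (y i)))) ⟩
        sum (λ j → sum (λ i → x j * (P j i * y i)))
          ≈⟨ sum-cong-≋ (λ j → *-distribˡ-sum (x j) (λ i → P j i * y i)) ⟨
        sum (λ j → x j * sum (λ i → P j i * y i)) ∎

      record Projects {m k} (V : Matrix m k) (P : Matrix m m) : Set (c ⊔ ℓ) where
        field
          P-sym  : P ᵀ ≋ᴹ P
          coeff  : Matrix k m
          within : V *ᴹ coeff ≋ᴹ P
          fixes  : P *ᴹ V ≋ᴹ V

      projects⇒ : ∀ {m k} {V : Matrix m k} {P} → Projects V P →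
                  IsOrthogonalProjector V P
      projects⇒ {V = V} {P} pr = record
        { symmetric  = P-sym
        ; idempotent = λ i j → begin
            (P *ᵛ column P j) i
              ≈⟨ ·-congˡ (P i) (λ k → within k j) ⟨
            (P *ᵛ V *ᵛ column coeff j) i
              ≈⟨ fixed (column coeff j) i ⟩
            (V *ᵛ column coeff j) i
              ≈⟨ within i j ⟩
            P i j ∎
        ; range⊆span = λ x → coeff *ᵛ x ,
            λ i → trans (*ᵛ-assoc V coeff x i) (·-congʳ x (within i))
        ; span⊆range = λ { y (a , Va≋y) → y , λ i → begin
            (P *ᵛ y) i        ≈⟨ ·-congˡ (P i) Va≋y ⟨
            (P *ᵛ V *ᵛ a) i   ≈⟨ fixed a i ⟩
            (V *ᵛ a) i        ≈⟨ Va≋y i ⟩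
            y i               ∎ }
        }
        where
        open Projects pr
        fixed : ∀ a → P *ᵛ V *ᵛ a ≋ V *ᵛ a
        fixed a i = trans (*ᵛ-assoc P V a i) (·-congʳ a (fixes i))

      module Extend {m k} (V : Matrix m (ℕ.suc k)) {P : Matrix m m}
                    (pr : Projects (λ i j → V i (suc j)) P) where
        open Projects pr

        V′ : Matrix m k
        V′ i j = V i (suc j)

        v b w : Vector Carrier _
        v = column V zero
        b = coeff *ᵛ v
        w i = v i - (P *ᵛ v) i

        V′b≋Pv : V′ *ᵛ b ≋ P *ᵛ v
        V′b≋Pv i = trans (*ᵛ-assoc V′ coeff v i) (·-congʳ v (within i))

        degenerate : w ≋ 0ᵛ → Projects V P
        degenerate w≋0 = record
          { P-sym  = P-sym
          ; coeff  = λ { zero _ → 0# ; (suc i) → coeff i }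
          ; within = λ i j → begin
              V i zero * 0# + (V′ *ᴹ coeff) i j
                ≈⟨ +-congʳ (zeroʳ _) ⟩
              0# + (V′ *ᴹ coeff) i j
                ≈⟨ +-identityˡ _ ⟩
              (V′ *ᴹ coeff) i j
                ≈⟨ within i j ⟩
              P i j ∎
          ; fixes  = λ { i zero    → sym (x∙y⁻¹≈ε⇒x≈y _ _ (w≋0 i))
                       ; i (suc j) → fixes i j }
          }

        w·-expand : ∀ y → w · y ≈ v · y - (P *ᵛ v) · y
        w·-expand y = begin
          w · y
            ≈⟨ ·-congʳ y (λ i → +-congˡ (neg ((P *ᵛ v) i))) ⟩
          (λ i → v i + - 1# * (P *ᵛ v) i) · y
            ≈⟨ ·-axpy v (- 1#) (P *ᵛ v) y ⟩
          v · y + - 1# * (P *ᵛ v) · y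
            ≈⟨ +-congˡ (neg _) ⟨
          v · y - (P *ᵛ v) · y ∎
          where
          neg : ∀ x → - x ≈ - 1# * x
          neg x = trans (-‿cong (sym (*-identityˡ x))) (-‿distribˡ-* 1# x)

        w⊥fixed : ∀ y → P *ᵛ y ≋ y → w · y ≈ 0#
        w⊥fixed y Py≋y = begin
          w · y                ≈⟨ w·-expand y ⟩
          v · y - (P *ᵛ v) · y ≈⟨ +-congˡ (-‿cong
                                    (trans (adjoint P P-sym v y) (·-congˡ v Py≋y))) ⟩
          v · y - v · y        ≈⟨ -‿inverseʳ _ ⟩
          0#                   ∎

        w·v : w · v ≈ ‖ w ‖²
        w·v = begin
          w · v
            ≈⟨ x-0 _ ⟨
          w · v - 0#
            ≈⟨ +-congˡ (-‿cong w·Pv) ⟨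
          w · v - w · (P *ᵛ v)
            ≈⟨ +-cong (·-comm w v) (-‿cong (·-comm w (P *ᵛ v))) ⟩
          v · w - (P *ᵛ v) · w
            ≈⟨ w·-expand w ⟨
          w · w ∎
          where
          x-0 : ∀ x → x - 0# ≈ x
          x-0 x = trans (+-congˡ -0≈0) (+-identityʳ x)
            where
            -0≈0 : - 0# ≈ 0#
            -0≈0 = trans (sym (+-identityˡ (- 0#))) (-‿inverseʳ 0#)
          w·Pv : w · (P *ᵛ v) ≈ 0#
          w·Pv = w⊥fixed (P *ᵛ v) λ i → begin
            (P *ᵛ P *ᵛ v) i   ≈⟨ *ᵛ-assoc P P v i ⟩
            ((P *ᴹ P) *ᵛ v) i ≈⟨ ·-congʳ v (IsOrthogonalProjector.idempotent
                                   (projects⇒ pr) i) ⟩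
            (P *ᵛ v) i        ∎

        module Generic (w≉0 : ‖ w ‖² ≉ 0#) where
          s : Carrier
          s = ‖ w ‖² ⁻¹

          P⁺ : Matrix m m
          P⁺ i j = P i j + s * w i * w j

          P⁺-apply : ∀ y i → (P⁺ *ᵛ y) i ≈ (P *ᵛ y) i + s * w i * w · y
          P⁺-apply y i = ·-axpy (P i) (s * w i) w y

          P⁺v : P⁺ *ᵛ v ≋ v
          P⁺v i = begin
            (P⁺ *ᵛ v) i
              ≈⟨ P⁺-apply v i ⟩
            (P *ᵛ v) i + s * w i * w · v
              ≈⟨ +-congˡ (*-congˡ w·v) ⟩
            (P *ᵛ v) i + s * w i * ‖ w ‖²
              ≈⟨ +-congˡ (trans (*-comm _ _) (sym (*-assoc ‖ w ‖² s (w i)))) ⟩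
            (P *ᵛ v) i + ‖ w ‖² * s * w i
              ≈⟨ +-congˡ (trans (*-congʳ (⁻¹-inverseʳ w≉0)) (*-identityˡ (w i))) ⟩
            (P *ᵛ v) i + (v i - (P *ᵛ v) i)
              ≈⟨ +-comm _ _ ⟩
            v i - (P *ᵛ v) i + (P *ᵛ v) i
              ≈⟨ +-assoc (v i) _ _ ⟩
            v i + (- (P *ᵛ v) i + (P *ᵛ v) i)
              ≈⟨ trans (+-congˡ (-‿inverseˡ _)) (+-identityʳ (v i)) ⟩
            v i ∎

          coeff⁺ : Matrix (ℕ.suc k) m
          coeff⁺ zero    j = s * w j
          coeff⁺ (suc l) j = coeff l j + - (s * w j) * b l

          within⁺ : V *ᴹ coeff⁺ ≋ᴹ P⁺
          within⁺ i j = begin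
            v i * t + V′ i · (λ l → coeff l j + - t * b l)
              ≈⟨ +-congˡ (trans (·-comm (V′ i) _)
                   (·-axpy (column coeff j) (- t) b (V′ i))) ⟩
            v i * t + (column coeff j · V′ i + - t * b · V′ i)
              ≈⟨ +-congˡ (+-cong
                   (trans (·-comm (column coeff j) (V′ i)) (within i j))
                   (*-congˡ (trans (·-comm b (V′ i)) (V′b≋Pv i)))) ⟩
            v i * t + (P i j + - t * (P *ᵛ v) i)
              ≈⟨ x∙yz≈y∙xz (v i * t) (P i j) _ ⟩
            P i j + (v i * t + - t * (P *ᵛ v) i)
              ≈⟨ +-congˡ (+-cong (*-comm (v i) t)
                   (trans (sym (-‿distribˡ-* t _)) (-‿distribʳ-* t _))) ⟩
            P i j + (t * v i + t * - (P *ᵛ v) i)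
              ≈⟨ +-congˡ (distribˡ t (v i) _) ⟨
            P i j + t * w i
              ≈⟨ +-congˡ (xy∙z≈xz∙y s (w j) (w i)) ⟩
            P i j + s * w i * w j ∎
            where
            t : Carrier
            t = s * w j

          projects : Projects V P⁺
          projects = record
            { P-sym  = λ i j → +-cong (P-sym i j) (xy∙z≈xz∙y s (w j) (w i))
            ; coeff  = coeff⁺
            ; within = within⁺
            ; fixes  = λ { i zero    → P⁺v i
                         ; i (suc j) → begin
                (P⁺ *ᵛ column V′ j) i
                  ≈⟨ P⁺-apply (column V′ j) i ⟩
                (P *ᵛ column V′ j) i + s * w i * w · column V′ j
                  ≈⟨ +-cong (fixes i j)
                       (*-congˡ (w⊥fixed (column V′ j) (λ l → fixes l j))) ⟩
                V′ i j + s * w i * 0#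
                  ≈⟨ trans (+-congˡ (zeroʳ _)) (+-identityʳ _) ⟩
                V′ i j ∎ }
            }

      construct : ∀ {m} k (V : Matrix m k) → ∃ (Projects V)
      construct {m} ℕ.zero V = (λ _ _ → 0#) , record
        { P-sym  = λ _ _ → refl
        ; coeff  = λ ()
        ; within = λ _ _ → refl
        ; fixes  = λ _ ()
        }
      construct (ℕ.suc k) V with construct k (λ i j → V i (suc j))
      ... | P , pr with ‖ Extend.w V pr ‖² Order.≟ 0#
      ...   | yes w≈0 = P , Extend.degenerate V pr (‖‖²-zero _ w≈0)
      ...   | no  w≉0 = _ , Extend.Generic.projects V pr w≉0

  abstract
    orthogonalProjector : ∀ {m k} (V : Matrix m k) →
                          ∃ (IsOrthogonalProjector V)
    orthogonalProjector V =
      let P , pr = GramSchmidt.construct _ V in P , GramSchmidt.projects⇒ pr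

  Π : ∀ {m k} → Matrix m k → Matrix m m
  Π V = proj₁ (orthogonalProjector V)

  f : ∀ {m n k} → Matrix m n → Matrix m k → Carrier
  f M V = ‖ Π V *ᴹ M ‖F²

  record IsUnitRescaling {m} (x u : Vector Carrier m) : Set (c ⊔ ℓ) where
    field
      scale    : Carrier
      positive : 0# < scale
      scaled   : u ≋ (λ i → scale * x i)
      unit     : ‖ u ‖² ≈ 1#

  -- For k = 0 no σ qualifies: there are no unit vectors, so the infimum is +∞.

  IsσMin : ∀ {m k} → Matrix m k → Pred Carrier (c ⊔ ℓ)
  IsσMin {m} {k} V σ = ∃[ M ]
    (∀ j → IsUnitRescaling (column V j) (column M j)) ×
    IsInfimum (λ y → ∃[ x ] ‖ x ‖² ≈ 1# × y ≈ ‖ M *ᵛ x ‖²) σ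

  -- A set of columns of B is a set of column indices, so that equal columns at
  -- different positions count as different.  B ↾ S is the submatrix of the
  -- columns selected by S, in increasing order of index.

  enumerate : ∀ {n} (S : Subset n) → Fin ∣ S ∣ → Fin n
  enumerate (true  ∷ S) zero    = zero
  enumerate (true  ∷ S) (suc i) = suc (enumerate S i)
  enumerate (false ∷ S) i       = suc (enumerate S i)

  _↾_ : ∀ {m n} → Matrix m n → (S : Subset n) → Matrix m ∣ S ∣
  (B ↾ S) i j = B i (enumerate S j)

  module _ {m nA nB} (A : Matrix m nA) (B : Matrix m nB) where

    record IsOptimal (k : ℕ) (S : Subset nB) : Set ℓ where
      field
        size    : ∣ S ∣ ≡ k
        maximal : ∀ S′ → ∣ S′ ∣ ≡ k → f A (B ↾ S′) ≤ f A (B ↾ S)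

    -- Greedy r S: S is a possible output after r rounds, ties being broken
    -- arbitrarily.

    data Greedy : ℕ → Subset nB → Set ℓ where
      start : Greedy 0 ⊥
      pick  : ∀ {i S} → Greedy i S → ∀ j →
              (∀ j′ → f A (B ↾ (S ∪ ⁅ j′ ⁆)) ≤ f A (B ↾ (S ∪ ⁅ j ⁆))) →
              Greedy (ℕ.suc i) (S ∪ ⁅ j ⁆)

{-# OPTIONS --safe #-}
module Submission where

-- Let P and Q be the projectors onto the spans of the current greedy set and
-- of OPT, r = a − P a for a column a of A, and M the normalised OPT.  Adding a
-- unit vector u to the greedy set gains at least ∑ₐ ⟨u , r⟩², so if no element
-- of OPT gains more than g then ∑ₐ ‖Mᵀ r‖² ≤ k g.  On the other hand
-- Q a = M x with σ ‖x‖² ≤ ‖Q a‖², and ‖Q a‖² ≤ 2 ⟨x , Mᵀ r⟩ + ‖P a‖².  Young's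
-- inequality then bounds the gap δ = f(OPT) − f(greedy set) by
-- σ δ² ≤ 4 k f(OPT) g, and this recurrence forces i σ δᵢ ≤ 16 k f(OPT) after
-- i rounds.

open import Defs
open import Data.Bool.Base using (true; false)
open import Data.Fin.Base using (Fin; zero; suc)
open import Data.Fin.Subset using (Subset; ∣_∣; ⁅_⁆; _∪_; _∈_)
open import Data.Fin.Subset.Properties using (p⊆p∪q; q⊆p∪q; x∈⁅x⁆)
open import Data.Nat.Base as ℕ using (ℕ)
open import Data.Product.Base using (∃; _×_; _,_; proj₁; proj₂)
open import Data.Sum.Base using (_⊎_; inj₁; inj₂)
open import Data.Vec.Base using (_∷_; here; there)
open import Data.Vec.Functional using (Vector)
open import Function.Base using (_∘_)
open import Level using (Lift; lift)
open import Relation.Binary.Bundles using (Poset)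
open import Relation.Binary.PropositionalEquality.Core as ≡ using (_≡_)
open import Relation.Nullary using (yes; no; contradiction)
import Algebra.Properties.AbelianGroup
import Algebra.Properties.Semiring.Mult
import Algebra.Properties.Semiring.Sum
import Algebra.Solver.Ring.NaturalCoefficients.Default
import Data.Vec.Functional.Relation.Binary.Equality.Setoid
import Relation.Binary.Reasoning.PartialOrder

-- Arithmetic of ordered fields, and square roots.

module OrderedField {c ℓ} (ℝ : Reals c ℓ) where
  open Reals ℝ
  open Algebra.Properties.AbelianGroup +-abelianGroup public
    using () renaming (∙-cancelˡ to +-cancelˡ)
  module Solver =
    Algebra.Solver.Ring.NaturalCoefficients.Default commutativeSemiring
  open Solver using (solve; _:=_; _:+_; _:*_; con)

  ≤-poset : Poset c ℓ ℓ
  ≤-poset = record { isPartialOrder = Order.isPartialOrder }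

  module ≤-Reasoning = Relation.Binary.Reasoning.PartialOrder ≤-poset
  open ≤-Reasoning

  +-mono-≤ : ∀ {a b x y} → a ≤ b → x ≤ y → a + x ≤ b + y
  +-mono-≤ {a} {b} {x} {y} a≤b x≤y = begin
    a + x ≤⟨ +-monoˡ-≤ x a≤b ⟩
    b + x ≈⟨ +-comm b x ⟩
    x + b ≤⟨ +-monoˡ-≤ b x≤y ⟩
    y + b ≈⟨ +-comm y b ⟩
    b + y ∎

  x+[y-x]≈y : ∀ x y → x + (y - x) ≈ y
  x+[y-x]≈y x y = begin-equality
    x + (y - x)   ≈⟨ +-comm x (y - x) ⟩
    y - x + x     ≈⟨ +-assoc y (- x) x ⟩
    y + (- x + x) ≈⟨ +-congˡ (-‿inverseˡ x) ⟩
    y + 0#        ≈⟨ +-identityʳ y ⟩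
    y             ∎

  +-cancelʳ-≤ : ∀ z {x y} → x + z ≤ y + z → x ≤ y
  +-cancelʳ-≤ z {x} {y} x+z≤y+z = begin
    x           ≈⟨ cancel x ⟨
    x + z - z   ≤⟨ +-monoˡ-≤ (- z) x+z≤y+z ⟩
    y + z - z   ≈⟨ cancel y ⟩
    y           ∎
    where
    cancel : ∀ w → w + z - z ≈ w
    cancel w = trans (+-assoc w z (- z))
      (trans (+-congˡ (-‿inverseʳ z)) (+-identityʳ w))

  ≤⇒0≤y-x : ∀ {x y} → x ≤ y → 0# ≤ y - x
  ≤⇒0≤y-x {x} {y} x≤y = +-cancelʳ-≤ x (begin
    0# + x    ≈⟨ +-identityˡ x ⟩
    x         ≤⟨ x≤y ⟩
    y         ≈⟨ x+[y-x]≈y x y ⟨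
    x + (y - x) ≈⟨ +-comm x _ ⟩
    y - x + x ∎)

  x≤x+y : ∀ x {y} → 0# ≤ y → x ≤ x + y
  x≤x+y x {y} 0≤y = begin
    x      ≈⟨ +-identityʳ x ⟨
    x + 0# ≤⟨ +-mono-≤ Order.refl 0≤y ⟩
    x + y  ∎

  +-nonneg : ∀ {x y} → 0# ≤ x → 0# ≤ y → 0# ≤ x + y
  +-nonneg {x} 0≤x 0≤y = Order.trans 0≤x (x≤x+y x 0≤y)

  *-monoˡ-≤ : ∀ {z x y} → 0# ≤ z → x ≤ y → z * x ≤ z * y
  *-monoˡ-≤ {z} {x} {y} 0≤z x≤y = begin
    z * x               ≤⟨ x≤x+y _ (*-nonneg 0≤z (≤⇒0≤y-x x≤y)) ⟩
    z * x + z * (y - x) ≈⟨ distribˡ z x (y - x) ⟨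
    z * (x + (y - x))   ≈⟨ *-congˡ (x+[y-x]≈y x y) ⟩
    z * y               ∎

  *-monoʳ-≤ : ∀ {z x y} → 0# ≤ z → x ≤ y → x * z ≤ y * z
  *-monoʳ-≤ {z} {x} {y} 0≤z x≤y = begin
    x * z ≈⟨ *-comm x z ⟩
    z * x ≤⟨ *-monoˡ-≤ 0≤z x≤y ⟩
    z * y ≈⟨ *-comm z y ⟩
    y * z ∎

  *-mono-≤ : ∀ {x y u v} → 0# ≤ x → 0# ≤ v → x ≤ y → u ≤ v → x * u ≤ y * v
  *-mono-≤ 0≤x 0≤v x≤y u≤v = Order.trans (*-monoˡ-≤ 0≤x u≤v) (*-monoʳ-≤ 0≤v x≤y)

  *⁻¹-cancelˡ : ∀ {z} x → z ≉ 0# → z ⁻¹ * (z * x) ≈ x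
  *⁻¹-cancelˡ {z} x z≉0 = begin-equality
    z ⁻¹ * (z * x) ≈⟨ *-assoc (z ⁻¹) z x ⟨
    z ⁻¹ * z * x   ≈⟨ *-congʳ (trans (*-comm _ _) (⁻¹-inverseʳ z≉0)) ⟩
    1# * x         ≈⟨ *-identityˡ x ⟩
    x              ∎

  *-cancelˡ : ∀ {z x y} → z ≉ 0# → z * x ≈ z * y → x ≈ y
  *-cancelˡ {z} {x} {y} z≉0 zx≈zy = begin-equality
    x              ≈⟨ *⁻¹-cancelˡ x z≉0 ⟨
    z ⁻¹ * (z * x) ≈⟨ *-congˡ zx≈zy ⟩
    z ⁻¹ * (z * y) ≈⟨ *⁻¹-cancelˡ y z≉0 ⟩
    y              ∎

  x/y*y≈x : ∀ x {y} → y ≉ 0# → x / y * y ≈ x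
  x/y*y≈x x {y} y≉0 = begin-equality
    x * y ⁻¹ * y   ≈⟨ *-assoc x (y ⁻¹) y ⟩
    x * (y ⁻¹ * y) ≈⟨ *-congˡ (trans (*-comm _ _) (⁻¹-inverseʳ y≉0)) ⟩
    x * 1#         ≈⟨ *-identityʳ x ⟩
    x              ∎

  0<⇒≉0 : ∀ {x} → 0# < x → x ≉ 0#
  0<⇒≉0 (_ , 0≉x) x≈0 = 0≉x (sym x≈0)

  *-cancelˡ-≤ : ∀ {z x y} → 0# < z → z * x ≤ z * y → x ≤ y
  *-cancelˡ-≤ {z} {x} {y} 0<z zx≤zy with Order.total x y
  ... | inj₁ x≤y = x≤y
  ... | inj₂ y≤x = Order.reflexive (*-cancelˡ (0<⇒≉0 0<z)
                     (Order.antisym zx≤zy (*-monoˡ-≤ (proj₁ 0<z) y≤x)))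

  0<-≤-trans : ∀ {x y} → 0# < x → x ≤ y → 0# < y
  0<-≤-trans {x} (0≤x , 0≉x) x≤y = Order.trans 0≤x x≤y ,
    λ 0≈y → 0≉x (Order.antisym 0≤x (Order.≤-respʳ-≈ (sym 0≈y) x≤y))

  *-pos : ∀ {x y} → 0# < x → 0# < y → 0# < x * y
  *-pos {x} {y} 0<x (0≤y , 0≉y) = *-nonneg (proj₁ 0<x) 0≤y ,
    λ 0≈xy → 0≉y (*-cancelˡ (0<⇒≉0 0<x) (trans (zeroʳ x) 0≈xy))

  +-pos : ∀ {x y} → 0# < x → 0# ≤ y → 0# < x + y
  +-pos {x} 0<x 0≤y = 0<-≤-trans 0<x (x≤x+y x 0≤y)

  *-cancelˡ-0≤ : ∀ {z x} → 0# < z → 0# ≤ z * x → 0# ≤ x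
  *-cancelˡ-0≤ {z} 0<z 0≤zx = *-cancelˡ-≤ 0<z (Order.≤-respˡ-≈ (sym (zeroʳ z)) 0≤zx)

  -- The sides differ by d² with d = y - x, and 0 ≤ d makes d² nonnegative. Writing y as x + d keeps
  -- the identity free of subtraction, as the semiring solver requires.
  x≤y⇒2xy≤x²+y² : ∀ {x y} → x ≤ y → x * y + x * y ≤ x * x + y * y
  x≤y⇒2xy≤x²+y² {x} {y} x≤y = begin
    x * y + x * y                     ≤⟨ x≤x+y _ (*-nonneg 0≤d 0≤d) ⟩
    x * y + x * y + d * d             ≈⟨ +-congʳ (+-cong (*-congˡ y≈) (*-congˡ y≈)) ⟩
    x * (x + d) + x * (x + d) + d * d ≈⟨ solve 2 (λ x d →
      x :* (x :+ d) :+ x :* (x :+ d) :+ d :* d :=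
      x :* x :+ (x :+ d) :* (x :+ d)) refl x d ⟩
    x * x + (x + d) * (x + d)         ≈⟨ +-congˡ (*-cong y≈ y≈) ⟨
    x * x + y * y                     ∎
    where
    d : Carrier
    d = y - x
    0≤d : 0# ≤ d
    0≤d = ≤⇒0≤y-x x≤y
    y≈ : y ≈ x + d
    y≈ = sym (x+[y-x]≈y x y)

  2xy≤x²+y² : ∀ x y → x * y + x * y ≤ x * x + y * y
  2xy≤x²+y² x y with Order.total x y
  ... | inj₁ x≤y = x≤y⇒2xy≤x²+y² x≤y
  ... | inj₂ y≤x = begin
    x * y + x * y ≈⟨ +-cong (*-comm x y) (*-comm x y) ⟩
    y * x + y * x ≤⟨ x≤y⇒2xy≤x²+y² y≤x ⟩
    y * y + x * x ≈⟨ +-comm _ _ ⟩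
    x * x + y * y ∎

  0≤x² : ∀ x → 0# ≤ x * x
  0≤x² x = begin
    0#              ≈⟨ +-identityʳ 0# ⟨
    0# + 0#         ≈⟨ +-cong (zeroˡ x) (zeroˡ x) ⟨
    0# * x + 0# * x ≤⟨ 2xy≤x²+y² 0# x ⟩
    0# * 0# + x * x ≈⟨ +-congʳ (zeroˡ 0#) ⟩
    0# + x * x      ≈⟨ +-identityˡ _ ⟩
    x * x           ∎

  0<1 : 0# < 1#
  0<1 = Order.≤-respʳ-≈ (*-identityˡ 1#) (0≤x² 1#) , 0≉1

  0≤fromℕ : ∀ n → 0# ≤ fromℕ n
  0≤fromℕ ℕ.zero    = Order.refl
  0≤fromℕ (ℕ.suc n) = +-nonneg (proj₁ 0<1) (0≤fromℕ n)

  x²≤y²⇒x≤y : ∀ {x y} → 0# < y → x * x ≤ y * y → x ≤ y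
  x²≤y²⇒x≤y {x} {y} 0<y x²≤y² with Order.total x y
  ... | inj₁ x≤y = x≤y
  ... | inj₂ y≤x = *-cancelˡ-≤ 0<y (begin
    y * x ≤⟨ *-monoʳ-≤ (Order.trans (proj₁ 0<y) y≤x) y≤x ⟩
    x * x ≤⟨ x²≤y² ⟩
    y * y ∎)

  -- The supremum s of {x | x² ≤ a} is a root of a: the Newton iterate
  -- n = (s² + a) / 2s satisfies a ≤ n², so s ≤ n, that is s² ≤ a; and a / n
  -- belongs to the set, so a / n ≤ s, that is a ≤ s².
  module SquareRoot {a} (0<a : 0# < a) where
    0≤a : 0# ≤ a
    0≤a = proj₁ 0<a

    -- `Lift` raises the level ℓ of the order to the level c ⊔ ℓ of the predicates in `complete`.
    SquareBelow : Carrier → Set _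
    SquareBelow x = Lift c (x * x ≤ a)

    a≤n²⇒bound : ∀ {n} → 0# < n → a ≤ n * n → UpperBound SquareBelow n
    a≤n²⇒bound 0<n a≤n² x (lift x²≤a) = x²≤y²⇒x≤y 0<n (Order.trans x²≤a a≤n²)

    supremum : ∃ (IsSupremum SquareBelow)
    supremum = complete SquareBelow
      (0# , lift (Order.≤-respˡ-≈ (sym (zeroˡ 0#)) 0≤a))
      -- 1 + a is an upper bound because its square exceeds a by 1 + a + a².
      (1# + a , a≤n²⇒bound (+-pos 0<1 0≤a) (begin
        a                    ≤⟨ x≤x+y a (+-nonneg (+-nonneg (proj₁ 0<1) 0≤a) (0≤x² a)) ⟩
        a + (1# + a + a * a) ≈⟨ solve 1 (λ a →
          a :+ (con 1 :+ a :+ a :* a) :=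
          (con 1 :+ a) :* (con 1 :+ a)) refl a ⟩
        (1# + a) * (1# + a)  ∎))

    module Newton {s} (isSup : IsSupremum SquareBelow s) where
      -- The smaller of a and 1 is positive and belongs to the set.
      0<s : 0# < s
      0<s with Order.total a 1#
      ... | inj₁ a≤1 = 0<-≤-trans 0<a (proj₁ isSup a (lift (begin
        a * a  ≤⟨ *-monoˡ-≤ 0≤a a≤1 ⟩
        a * 1# ≈⟨ *-identityʳ a ⟩
        a      ∎)))
      ... | inj₂ 1≤a = 0<-≤-trans 0<1 (proj₁ isSup 1#
        (lift (Order.≤-respˡ-≈ (sym (*-identityˡ 1#)) 1≤a)))

      0<2s : 0# < s + s
      0<2s = +-pos 0<s (proj₁ 0<s)

      n : Carrier
      n = (s * s + a) / (s + s)

      2sn≈s²+a : (s + s) * n ≈ s * s + a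
      2sn≈s²+a = trans (*-comm _ n) (x/y*y≈x _ (0<⇒≉0 0<2s))

      0<s²+a : 0# < s * s + a
      0<s²+a = +-pos (*-pos 0<s 0<s) 0≤a

      0<n : 0# < n
      0<n = *-cancelˡ-0≤ 0<2s (Order.≤-respʳ-≈ (sym 2sn≈s²+a) (proj₁ 0<s²+a)) ,
        λ 0≈n → proj₂ 0<s²+a (trans (sym (zeroʳ _)) (trans (*-congˡ 0≈n) 2sn≈s²+a))

      -- After multiplication by (2s)² this is 4s²a ≤ (s² + a)², the AM-GM inequality for s² and a.
      a≤n² : a ≤ n * n
      a≤n² = *-cancelˡ-≤ (*-pos 0<2s 0<2s) (begin
        (s + s) * (s + s) * a
          ≈⟨ solve 2 (λ s a → (s :+ s) :* (s :+ s) :* a :=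
               s :* s :* a :+ s :* s :* a :+ (s :* s :* a :+ s :* s :* a)) refl s a ⟩
        s * s * a + s * s * a + (s * s * a + s * s * a)
          ≤⟨ +-monoˡ-≤ _ (2xy≤x²+y² (s * s) a) ⟩
        s * s * (s * s) + a * a + (s * s * a + s * s * a)
          ≈⟨ solve 2 (λ x a → x :* x :+ a :* a :+ (x :* a :+ x :* a) :=
               (x :+ a) :* (x :+ a)) refl (s * s) a ⟩
        (s * s + a) * (s * s + a)
          ≈⟨ *-cong 2sn≈s²+a 2sn≈s²+a ⟨
        (s + s) * n * ((s + s) * n)
          ≈⟨ solve 2 (λ t n → t :* n :* (t :* n) := t :* t :* (n :* n))
               refl (s + s) n ⟩
        (s + s) * (s + s) * (n * n) ∎)

      s²≤a : s * s ≤ a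
      s²≤a = +-cancelʳ-≤ (s * s) (begin
        s * s + s * s ≈⟨ distribʳ s s s ⟨
        (s + s) * s   ≤⟨ *-monoˡ-≤ (proj₁ 0<2s) (proj₂ isSup n (a≤n²⇒bound 0<n a≤n²)) ⟩
        (s + s) * n   ≈⟨ 2sn≈s²+a ⟩
        s * s + a     ≈⟨ +-comm _ a ⟩
        a + s * s     ∎)

      a/n*n≈a : a / n * n ≈ a
      a/n*n≈a = x/y*y≈x a (0<⇒≉0 0<n)

      -- Multiplied by n², the membership condition (a / n)² ≤ a becomes a² ≤ n²a, which follows
      -- from a ≤ n².
      a/n≤s : a / n ≤ s
      a/n≤s = proj₁ isSup (a / n) (lift (*-cancelˡ-≤ (*-pos 0<n 0<n) (begin
        n * n * (a / n * (a / n)) ≈⟨ solve 2 (λ n m →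
          n :* n :* (m :* m) := m :* n :* (m :* n)) refl n (a / n) ⟩
        a / n * n * (a / n * n)   ≈⟨ *-cong a/n*n≈a a/n*n≈a ⟩
        a * a                     ≤⟨ *-monoʳ-≤ 0≤a a≤n² ⟩
        n * n * a                 ∎)))

      a≤s² : a ≤ s * s
      a≤s² = +-cancelʳ-≤ a (begin
        a + a                     ≈⟨ +-cong a/n*n≈a a/n*n≈a ⟨
        a / n * n + a / n * n     ≤⟨ +-mono-≤ mn≤sn mn≤sn ⟩
        s * n + s * n             ≈⟨ distribʳ n s s ⟨
        (s + s) * n               ≈⟨ 2sn≈s²+a ⟩
        s * s + a                 ∎)
        where
        mn≤sn : a / n * n ≤ s * n
        mn≤sn = *-monoʳ-≤ (proj₁ 0<n) a/n≤s

  sqrt : ∀ {a} → 0# < a → ∃ λ s → s * s ≈ a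
  sqrt 0<a = proj₁ supremum , Order.antisym s²≤a a≤s²
    where
    open SquareRoot 0<a
    open Newton (proj₂ supremum)

-- Inner products, squared norms and matrix-vector products.

module Projections {c ℓ} (ℝ : Reals c ℓ) where
  open LinearAlgebra ℝ
  open OrderedField ℝ
  open ≤-Reasoning
  open Solver using (solve; _:=_; _:+_; _:*_; con)
  open Algebra.Properties.Semiring.Sum semiring
  open Data.Vec.Functional.Relation.Binary.Equality.Setoid setoid using (_≋_)

  infix 8 _·_
  _·_ : ∀ {m} → Vector Carrier m → Vector Carrier m → Carrier
  x · y = sum (λ i → x i * y i)

  sum-mono-≤ : ∀ {n} {x y : Vector Carrier n} → (∀ i → x i ≤ y i) → sum x ≤ sum y
  sum-mono-≤ {ℕ.zero}  x≤y = Order.refl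
  sum-mono-≤ {ℕ.suc n} x≤y = +-mono-≤ (x≤y zero) (sum-mono-≤ (x≤y ∘ suc))

  sum-nonneg : ∀ {n} {x : Vector Carrier n} → (∀ i → 0# ≤ x i) → 0# ≤ sum x
  sum-nonneg {ℕ.zero}  0≤x = Order.refl
  sum-nonneg {ℕ.suc n} 0≤x = +-nonneg (0≤x zero) (sum-nonneg (0≤x ∘ suc))

  sum≤n*bound : ∀ {n} {x : Vector Carrier n} {b} → (∀ i → x i ≤ b) →
                sum x ≤ fromℕ n * b
  sum≤n*bound {ℕ.zero}          x≤b = Order.reflexive (sym (zeroˡ _))
  sum≤n*bound {ℕ.suc n} {x} {b} x≤b = begin
    x zero + sum (x ∘ suc) ≤⟨ +-mono-≤ (x≤b zero) (sum≤n*bound (x≤b ∘ suc)) ⟩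
    b + fromℕ n * b        ≈⟨ +-congʳ (*-identityˡ b) ⟨
    1# * b + fromℕ n * b   ≈⟨ distribʳ b 1# (fromℕ n) ⟨
    (1# + fromℕ n) * b     ∎

  ·-congʳ : ∀ {m} {x x′ : Vector Carrier m} y → x ≋ x′ → x · y ≈ x′ · y
  ·-congʳ y e = sum-cong-≋ (λ i → *-congʳ (e i))

  ·-congˡ : ∀ {m} x {y y′ : Vector Carrier m} → y ≋ y′ → x · y ≈ x · y′
  ·-congˡ x e = sum-cong-≋ (λ i → *-congˡ (e i))

  ·-comm : ∀ {m} (x y : Vector Carrier m) → x · y ≈ y · x
  ·-comm x y = sum-cong-≋ (λ i → *-comm (x i) (y i))

  ·-distribˡ-+ : ∀ {m} x {y p d : Vector Carrier m} → (∀ i → y i ≈ p i + d i) →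
                 x · y ≈ x · p + x · d
  ·-distribˡ-+ x {y} {p} {d} y≈p+d = begin-equality
    x · y
      ≈⟨ sum-cong-≋ (λ i → trans (*-congˡ (y≈p+d i)) (distribˡ (x i) (p i) (d i))) ⟩
    sum (λ i → x i * p i + x i * d i)
      ≈⟨ ∑-distrib-+ (λ i → x i * p i) (λ i → x i * d i) ⟩
    x · p + x · d ∎

  ·-scaleʳ : ∀ {m} x t (y : Vector Carrier m) → x · (λ i → t * y i) ≈ t * x · y
  ·-scaleʳ x t y = begin-equality
    sum (λ i → x i * (t * y i))
      ≈⟨ sum-cong-≋ (λ i → solve 3 (λ x t y → x :* (t :* y) := t :* (x :* y))
           refl (x i) t (y i)) ⟩
    sum (λ i → t * (x i * y i))
      ≈⟨ *-distribˡ-sum t (λ i → x i * y i) ⟨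
    t * x · y ∎

  ‖‖²-scale : ∀ {m} t (x : Vector Carrier m) → ‖ (λ i → t * x i) ‖² ≈ t * t * ‖ x ‖²
  ‖‖²-scale t x = begin-equality
    (λ i → t * x i) · (λ i → t * x i) ≈⟨ ·-scaleʳ _ t x ⟩
    t * (λ i → t * x i) · x           ≈⟨ *-congˡ (·-comm _ x) ⟩
    t * x · (λ i → t * x i)           ≈⟨ *-congˡ (·-scaleʳ x t x) ⟩
    t * (t * ‖ x ‖²)                  ≈⟨ *-assoc t t _ ⟨
    t * t * ‖ x ‖²                    ∎

  ‖‖²-cong : ∀ {m} {x y : Vector Carrier m} → x ≋ y → ‖ x ‖² ≈ ‖ y ‖²
  ‖‖²-cong x≋y = sum-cong-≋ (λ i → *-cong (x≋y i) (x≋y i))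

  ‖‖²-nonneg : ∀ {m} (x : Vector Carrier m) → 0# ≤ ‖ x ‖²
  ‖‖²-nonneg x = sum-nonneg (λ i → 0≤x² (x i))

  2x·y≤‖x‖²+‖y‖² : ∀ {m} (x y : Vector Carrier m) → x · y + x · y ≤ ‖ x ‖² + ‖ y ‖²
  2x·y≤‖x‖²+‖y‖² x y = begin
    x · y + x · y
      ≈⟨ ∑-distrib-+ (λ i → x i * y i) (λ i → x i * y i) ⟨
    sum (λ i → x i * y i + x i * y i)
      ≤⟨ sum-mono-≤ (λ i → 2xy≤x²+y² (x i) (y i)) ⟩
    sum (λ i → x i * x i + y i * y i)
      ≈⟨ ∑-distrib-+ (λ i → x i * x i) (λ i → y i * y i) ⟩
    ‖ x ‖² + ‖ y ‖² ∎

  -- This is 2⟨x , y⟩ ≤ ‖x‖² + ‖y‖² for the vectors s x and t y. The weights stay free so that they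
  -- can be chosen once for all columns of A, after summation.
  young : ∀ {m} s t (x y : Vector Carrier m) →
          s * t * x · y + s * t * x · y ≤ s * s * ‖ x ‖² + t * t * ‖ y ‖²
  young s t x y = begin
    s * t * x · y + s * t * x · y ≈⟨ +-cong scaled scaled ⟨
    sx · ty + sx · ty             ≤⟨ 2x·y≤‖x‖²+‖y‖² sx ty ⟩
    ‖ sx ‖² + ‖ ty ‖²             ≈⟨ +-cong (‖‖²-scale s x) (‖‖²-scale t y) ⟩
    s * s * ‖ x ‖² + t * t * ‖ y ‖² ∎
    where
    sx ty : Vector Carrier _
    sx i = s * x i
    ty i = t * y i
    scaled : sx · ty ≈ s * t * x · y
    scaled = begin-equality
      sx · ty         ≈⟨ ·-scaleʳ sx t y ⟩
      t * sx · y      ≈⟨ *-congˡ (trans (·-comm sx y) (·-scaleʳ y s x)) ⟩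
      t * (s * y · x) ≈⟨ *-congˡ (*-congˡ (·-comm y x)) ⟩
      t * (s * x · y) ≈⟨ solve 3 (λ s t p → t :* (s :* p) := s :* t :* p)
                           refl s t (x · y) ⟩
      s * t * x · y   ∎

  -- Cauchy-Schwarz for a unit vector: Young's inequality with weights β = ⟨u , x⟩ and 1 reads 2β² ≤
  -- β² + ‖x‖².
  [u·x]²≤‖x‖² : ∀ {m} {u : Vector Carrier m} → ‖ u ‖² ≈ 1# → ∀ x →
                u · x * u · x ≤ ‖ x ‖²
  [u·x]²≤‖x‖² {u = u} ‖u‖²≈1 x = +-cancelʳ-≤ (β * β) (begin
    β * β + β * β                      ≈⟨ +-cong β² β² ⟨
    β * 1# * β + β * 1# * β            ≤⟨ young β 1# u x ⟩
    β * β * ‖ u ‖² + 1# * 1# * ‖ x ‖²  ≈⟨ +-congʳ (*-congˡ ‖u‖²≈1) ⟩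
    β * β * 1# + 1# * 1# * ‖ x ‖²      ≈⟨ solve 2 (λ b n →
      b :* con 1 :+ con 1 :* con 1 :* n := n :+ b) refl (β * β) ‖ x ‖² ⟩
    ‖ x ‖² + β * β                     ∎)
    where
    β : Carrier
    β = u · x
    β² : β * 1# * β ≈ β * β
    β² = *-congʳ (*-identityʳ β)

  *ᵛ-cong : ∀ {m n} (M : Matrix m n) {x y} → x ≋ y → M *ᵛ x ≋ M *ᵛ y
  *ᵛ-cong M x≋y i = ·-congˡ (M i) x≋y

  *ᵛ-assoc : ∀ {m n p} (M : Matrix m n) (N : Matrix n p) a →
             M *ᵛ N *ᵛ a ≋ (M *ᴹ N) *ᵛ a
  *ᵛ-assoc M N a i = begin-equality
    sum (λ k → M i k * sum (λ j → N k j * a j))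
      ≈⟨ sum-cong-≋ (λ k → trans (*-distribˡ-sum (M i k) (λ j → N k j * a j))
           (sum-cong-≋ (λ j → sym (*-assoc (M i k) (N k j) (a j))))) ⟩
    sum (λ k → sum (λ j → M i k * N k j * a j))
      ≈⟨ ∑-comm (λ k j → M i k * N k j * a j) ⟩
    sum (λ j → sum (λ k → M i k * N k j * a j))
      ≈⟨ sum-cong-≋ (λ j → *-distribʳ-sum (a j) (λ k → M i k * N k j)) ⟨
    sum (λ j → sum (λ k → M i k * N k j) * a j) ∎

  adjoint : ∀ {m n} (M : Matrix m n) x y → (M *ᵛ x) · y ≈ x · (M ᵀ *ᵛ y)
  adjoint M x y = begin-equality
    sum (λ i → sum (λ j → M i j * x j) * y i)
      ≈⟨ sum-cong-≋ (λ i → *-distribʳ-sum (y i) (λ j → M i j * x j)) ⟩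
    sum (λ i → sum (λ j → M i j * x j * y i))
      ≈⟨ ∑-comm (λ i j → M i j * x j * y i) ⟩
    sum (λ j → sum (λ i → M i j * x j * y i))
      ≈⟨ sum-cong-≋ (λ j → sum-cong-≋ (λ i →
           solve 3 (λ m x y → m :* x :* y := x :* (m :* y))
             refl (M i j) (x j) (y i))) ⟩
    sum (λ j → sum (λ i → x j * (M i j * y i)))
      ≈⟨ sum-cong-≋ (λ j → *-distribˡ-sum (x j) (λ i → M i j * y i)) ⟨
    sum (λ j → x j * sum (λ i → M i j * y i)) ∎

  eᵛ : ∀ {n} → Fin n → Vector Carrier n
  eᵛ zero    zero    = 1#
  eᵛ zero    (suc j) = 0#
  eᵛ (suc i) zero    = 0#
  eᵛ (suc i) (suc j) = eᵛ i j

  ·-eᵛ : ∀ {n} (x : Vector Carrier n) j → x · eᵛ j ≈ x j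
  ·-eᵛ {ℕ.suc n} x zero = begin-equality
    x zero * 1# + (λ i → x (suc i)) · 0ᵛ
      ≈⟨ +-cong (*-identityʳ _) (trans (sum-cong-≋ (λ i → zeroʳ (x (suc i))))
           (sum-replicate-zero n)) ⟩
    x zero + 0#
      ≈⟨ +-identityʳ _ ⟩
    x zero ∎
  ·-eᵛ {ℕ.suc n} x (suc j) = begin-equality
    x zero * 0# + (λ i → x (suc i)) · eᵛ j
      ≈⟨ +-cong (zeroʳ _) (·-eᵛ (λ i → x (suc i)) j) ⟩
    0# + x (suc j)
      ≈⟨ +-identityˡ _ ⟩
    x (suc j) ∎

  -- Orthogonal projectors, residuals and gains.

  module Projector {m k} (V : Matrix m k) where
    open IsOrthogonalProjector (proj₂ (orthogonalProjector V)) public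

    P : Vector Carrier m → Vector Carrier m
    P x = Π V *ᵛ x

    -- A vector of the span has the form P x, and P (P x) = P x by idempotence.
    fixes : ∀ {y} → Span V y → P y ≋ y
    fixes {y} y∈ i with span⊆range y y∈
    ... | x , Px≋y = begin-equality
      P y i                  ≈⟨ *ᵛ-cong (Π V) Px≋y i ⟨
      P (P x) i              ≈⟨ *ᵛ-assoc (Π V) (Π V) x i ⟩
      ((Π V *ᴹ Π V) *ᵛ x) i  ≈⟨ ·-congʳ x (idempotent i) ⟩
      P x i                  ≈⟨ Px≋y i ⟩
      y i                    ∎

    fixes-column : ∀ j → P (column V j) ≋ column V j
    fixes-column j = fixes (eᵛ j , λ i → ·-eᵛ (V i) j)

    fixes-image : ∀ x → P (P x) ≋ P x
    fixes-image x = fixes (range⊆span x)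

    -- By symmetry P moves over to y, which it fixes.
    fixed-·-P : ∀ {y} → P y ≋ y → ∀ x → y · P x ≈ y · x
    fixed-·-P {y} Py≋y x = begin-equality
      y · P x          ≈⟨ ·-comm y (P x) ⟩
      P x · y          ≈⟨ adjoint (Π V) x y ⟩
      x · (Π V ᵀ *ᵛ y) ≈⟨ ·-congˡ x (λ i → ·-congʳ y (symmetric i)) ⟩
      x · P y          ≈⟨ ·-congˡ x Py≋y ⟩
      x · y            ≈⟨ ·-comm x y ⟩
      y · x            ∎

    -- Inclusion of spans is expressed by the projector of the larger span fixing the columns of the
    -- smaller one; linearity extends this to all combinations.
    fixes-span : ∀ {n} (W : Matrix m n) → (∀ j → P (column W j) ≋ column W j) →
                 ∀ {y} → Span W y → P y ≋ y
    fixes-span W fixes-W {y} (a , Wa≋y) i = begin-equality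
      P y i                 ≈⟨ *ᵛ-cong (Π V) Wa≋y i ⟨
      P (W *ᵛ a) i          ≈⟨ *ᵛ-assoc (Π V) W a i ⟩
      ((Π V *ᴹ W) *ᵛ a) i   ≈⟨ ·-congʳ a (λ j → fixes-W j i) ⟩
      (W *ᵛ a) i            ≈⟨ Wa≋y i ⟩
      y i                   ∎

  -- Splits f by columns of A, so that estimates for a single vector can be summed.
  f≈∑‖Πa‖² : ∀ {m n k} (A : Matrix m n) (V : Matrix m k) →
             f A V ≈ sum (λ l → ‖ Π V *ᵛ column A l ‖²)
  f≈∑‖Πa‖² A V = ∑-comm (λ i l → (Π V *ᴹ A) i l * (Π V *ᴹ A) i l)

  f-nonneg : ∀ {m n k} (A : Matrix m n) (V : Matrix m k) → 0# ≤ f A V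
  f-nonneg A V = sum-nonneg (λ i → ‖‖²-nonneg ((Π V *ᴹ A) i))

  residual : ∀ {m k} → Matrix m k → Vector Carrier m → Vector Carrier m
  residual V a i = a i - (Π V *ᵛ a) i

  ·-residual : ∀ {m k} (V : Matrix m k) (x a : Vector Carrier m) →
               x · a ≈ x · (Π V *ᵛ a) + x · residual V a
  ·-residual V x a = ·-distribˡ-+ x (λ i → sym (x+[y-x]≈y ((Π V *ᵛ a) i) (a i)))

  -- The component of a in span V′ ⊖ span V has the same inner product with u
  -- as the residual.
  module _ {m k k′} (V : Matrix m k) (V′ : Matrix m k′)
           (V⊆V′ : ∀ j → Π V′ *ᵛ column V j ≋ column V j) where
    private
      module P  = Projector V
      module P′ = Projector V′

    projection-gain : ∀ {u} → ‖ u ‖² ≈ 1# → Π V′ *ᵛ u ≋ u → ∀ a →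
      u · residual V a * u · residual V a + ‖ Π V *ᵛ a ‖² ≤ ‖ Π V′ *ᵛ a ‖²
    projection-gain {u} ‖u‖²≈1 P′u≋u a = begin
      u · r * u · r + ‖ p ‖² ≈⟨ +-congʳ (*-cong u·r≈u·d u·r≈u·d) ⟩
      u · d * u · d + ‖ p ‖² ≤⟨ +-monoˡ-≤ _ ([u·x]²≤‖x‖² ‖u‖²≈1 d) ⟩
      ‖ d ‖² + ‖ p ‖²        ≈⟨ pythagoras ⟨
      ‖ p′ ‖²                ∎
      where
      p p′ d r : Vector Carrier m
      p   = P.P a
      p′  = P′.P a
      d i = p′ i - p i
      r   = residual V a

      p′≈p+d : ∀ i → p′ i ≈ p i + d i
      p′≈p+d i = sym (x+[y-x]≈y (p i) (p′ i))

      -- Both sides equal ⟨u , a⟩ - ⟨u , p⟩, since u is fixed by the larger projector and so pairs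
      -- with p′ as it does with a.
      u·r≈u·d : u · r ≈ u · d
      u·r≈u·d = +-cancelˡ (u · p) _ _ (begin-equality
        u · p + u · r ≈⟨ ·-residual V u a ⟨
        u · a         ≈⟨ P′.fixed-·-P P′u≋u a ⟨
        u · p′        ≈⟨ ·-distribˡ-+ u p′≈p+d ⟩
        u · p + u · d ∎)

      -- p lies in both spans, so its inner products with p′, with a and with p agree.
      p·d≈0 : p · d ≈ 0#
      p·d≈0 = +-cancelˡ (p · p) _ _ (begin-equality
        p · p + p · d ≈⟨ ·-distribˡ-+ p p′≈p+d ⟨
        p · p′        ≈⟨ P′.fixed-·-P (P′.fixes-span V V⊆V′ (P.range⊆span a)) a ⟩
        p · a         ≈⟨ P.fixed-·-P (P.fixes-image a) a ⟨
        p · p         ≈⟨ +-identityʳ _ ⟨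
        p · p + 0#    ∎)

      pythagoras : ‖ p′ ‖² ≈ ‖ d ‖² + ‖ p ‖²
      pythagoras = begin-equality
        p′ · p′                       ≈⟨ ·-distribˡ-+ p′ p′≈p+d ⟩
        p′ · p + p′ · d               ≈⟨ +-cong (·-comm p′ p) (·-comm p′ d) ⟩
        p · p′ + d · p′               ≈⟨ +-cong (·-distribˡ-+ p p′≈p+d)
                                           (·-distribˡ-+ d p′≈p+d) ⟩
        p · p + p · d + (d · p + d · d)
          ≈⟨ +-cong (trans (+-congˡ p·d≈0) (+-identityʳ _))
               (+-congʳ (trans (·-comm d p) p·d≈0)) ⟩
        p · p + (0# + d · d)          ≈⟨ trans (+-congˡ (+-identityˡ _)) (+-comm _ _) ⟩
        d · d + p · p                 ∎

    f-gain : ∀ {u} → ‖ u ‖² ≈ 1# → Π V′ *ᵛ u ≋ u → ∀ {n} (A : Matrix m n) →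
      sum (λ l → u · residual V (column A l) * u · residual V (column A l))
        + f A V ≤ f A V′
    f-gain {u} ‖u‖²≈1 P′u≋u A = begin
      sum (λ l → β l * β l) + f A V
        ≈⟨ +-congˡ (f≈∑‖Πa‖² A V) ⟩
      sum (λ l → β l * β l) + sum (λ l → ‖ P.P (column A l) ‖²)
        ≈⟨ ∑-distrib-+ (λ l → β l * β l) (λ l → ‖ P.P (column A l) ‖²) ⟨
      sum (λ l → β l * β l + ‖ P.P (column A l) ‖²)
        ≤⟨ sum-mono-≤ (λ l → projection-gain ‖u‖²≈1 P′u≋u (column A l)) ⟩
      sum (λ l → ‖ P′.P (column A l) ‖²)
        ≈⟨ f≈∑‖Πa‖² A V′ ⟨
      f A V′ ∎
      where
      β : Vector Carrier _
      β l = u · residual V (column A l)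

  -- ⟨q , r⟩ = ‖q‖² − ⟨q , p⟩ for the projections q and p of a.
  projection-deficit : ∀ {m k k′} (W : Matrix m k′) (V : Matrix m k) a →
    ‖ Π W *ᵛ a ‖² ≤ (Π W *ᵛ a) · residual V a + (Π W *ᵛ a) · residual V a
                     + ‖ Π V *ᵛ a ‖²
  projection-deficit W V a = +-cancelʳ-≤ ‖ q ‖² (begin
    q · q + q · q
      ≈⟨ +-cong q·q q·q ⟩
    q · p + q · r + (q · p + q · r)
      ≈⟨ solve 2 (λ x y → x :+ y :+ (x :+ y) := x :+ x :+ (y :+ y))
           refl (q · p) (q · r) ⟩
    q · p + q · p + (q · r + q · r)
      -- The ‖q‖² produced here is cancelled against one of the two copies on the left.
      ≤⟨ +-monoˡ-≤ _ (2x·y≤‖x‖²+‖y‖² q p) ⟩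
    ‖ q ‖² + ‖ p ‖² + (q · r + q · r)
      ≈⟨ solve 3 (λ x y z → x :+ y :+ z := z :+ y :+ x)
           refl ‖ q ‖² ‖ p ‖² (q · r + q · r) ⟩
    q · r + q · r + ‖ p ‖² + ‖ q ‖² ∎)
    where
    module Q = Projector W
    p q r : Vector Carrier _
    p = Π V *ᵛ a
    q = Q.P a
    r = residual V a

    q·q : q · q ≈ q · p + q · r
    q·q = trans (Q.fixed-·-P (Q.fixes-image a) a) (·-residual V q a)

  -- Selected columns, their normalisation, and the smallest singular value.

  enumerate-surjective : ∀ {n} {S : Subset n} {j} → j ∈ S → ∃ λ i → enumerate S i ≡ j
  enumerate-surjective here = zero , ≡.refl
  enumerate-surjective {S = true ∷ S} (there j∈S) with enumerate-surjective j∈S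
  ... | i , eq = suc i , ≡.cong suc eq
  enumerate-surjective {S = false ∷ S} (there j∈S) with enumerate-surjective j∈S
  ... | i , eq = i , ≡.cong suc eq

  enumerate-∈ : ∀ {n} (S : Subset n) i → enumerate S i ∈ S
  enumerate-∈ (true  ∷ S) zero    = here
  enumerate-∈ (true  ∷ S) (suc i) = there (enumerate-∈ S i)
  enumerate-∈ (false ∷ S) i       = there (enumerate-∈ S i)

  fixes-selected : ∀ {m n} (B : Matrix m n) {S j} → j ∈ S →
                   Π (B ↾ S) *ᵛ column B j ≋ column B j
  fixes-selected B {S} j∈S with enumerate-surjective j∈S
  ... | i , ≡.refl = Projector.fixes-column (B ↾ S) i

  module Normalised {m k} (V M : Matrix m k)
                    (rescaling : ∀ j → IsUnitRescaling (column V j) (column M j)) where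
    private
      module R j = IsUnitRescaling (rescaling j)

    -- Dividing each coefficient by the positive scale of its column compensates for the rescaling.
    span⊆ : ∀ {y} → Span V y → Span M y
    span⊆ (a , Va≋y) = (λ j → R.scale j ⁻¹ * a j) , λ i →
      trans (sum-cong-≋ (λ j → begin-equality
        M i j * (R.scale j ⁻¹ * a j)
          ≈⟨ *-congʳ (R.scaled j i) ⟩
        R.scale j * V i j * (R.scale j ⁻¹ * a j)
          ≈⟨ solve 4 (λ s v t a → s :* v :* (t :* a) := t :* (s :* (v :* a)))
               refl (R.scale j) (V i j) (R.scale j ⁻¹) (a j) ⟩
        R.scale j ⁻¹ * (R.scale j * (V i j * a j))
          ≈⟨ *⁻¹-cancelˡ _ (0<⇒≉0 (R.positive j)) ⟩
        V i j * a j ∎)) (Va≋y i)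

    -- Stated for one column at a time: the enlarged greedy span is only known to contain the one
    -- column of OPT that was added.
    fixes-normalised : ∀ (P : Matrix m m) j → P *ᵛ column V j ≋ column V j →
                       P *ᵛ column M j ≋ column M j
    fixes-normalised P j Pv≋v i = begin-equality
      (P *ᵛ column M j) i               ≈⟨ *ᵛ-cong P (R.scaled j) i ⟩
      P i · (λ p → R.scale j * V p j)   ≈⟨ ·-scaleʳ (P i) (R.scale j) (column V j) ⟩
      R.scale j * (P *ᵛ column V j) i   ≈⟨ *-congˡ (Pv≋v i) ⟩
      R.scale j * V i j                 ≈⟨ R.scaled j i ⟨
      M i j                             ∎

  -- Homogeneity: σ bounds ‖M u‖² for unit vectors u only, and x / s is one when s² = ‖x‖² is
  -- nonzero. This is what square roots are for.
  σ‖x‖²≤‖Mx‖²-via-root : ∀ {m k} (M : Matrix m k) {σ} →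
    LowerBound (λ y → ∃ λ x → ‖ x ‖² ≈ 1# × y ≈ ‖ M *ᵛ x ‖²) σ →
    ∀ x {s} → s * s ≈ ‖ x ‖² → ‖ x ‖² ≉ 0# → σ * ‖ x ‖² ≤ ‖ M *ᵛ x ‖²
  σ‖x‖²≤‖Mx‖²-via-root M {σ} lower x {s} s²≈‖x‖² ‖x‖²≉0 = begin
    σ * ‖ x ‖²
      ≈⟨ trans (*-comm σ _) (*-congʳ (sym s²≈‖x‖²)) ⟩
    s * s * σ
      ≤⟨ *-monoˡ-≤ (0≤x² s) (lower _ (u , ‖u‖²≈1 , refl)) ⟩
    s * s * ‖ M *ᵛ u ‖²
      ≈⟨ *-congˡ (‖‖²-cong (λ i → ·-scaleʳ (M i) t x)) ⟩
    s * s * ‖ (λ i → t * (M *ᵛ x) i) ‖²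
      ≈⟨ *-congˡ (‖‖²-scale t (M *ᵛ x)) ⟩
    s * s * (t * t * ‖ M *ᵛ x ‖²)
      ≈⟨ s²t² ‖ M *ᵛ x ‖² ⟩
    ‖ M *ᵛ x ‖² ∎
    where
    t : Carrier
    t = s ⁻¹

    u : Vector Carrier _
    u i = t * x i

    s≉0 : s ≉ 0#
    s≉0 s≈0 = ‖x‖²≉0 (trans (sym s²≈‖x‖²) (trans (*-congˡ s≈0) (zeroʳ s)))

    s²t² : ∀ y → s * s * (t * t * y) ≈ y
    s²t² y = begin-equality
      s * s * (t * t * y)   ≈⟨ solve 3 (λ s t y →
        s :* s :* (t :* t :* y) := t :* (s :* (t :* (s :* y)))) refl s t y ⟩
      t * (s * (t * (s * y))) ≈⟨ trans (*⁻¹-cancelˡ _ s≉0) (*⁻¹-cancelˡ y s≉0) ⟩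
      y                       ∎

    ‖u‖²≈1 : ‖ u ‖² ≈ 1#
    ‖u‖²≈1 = begin-equality
      ‖ u ‖²               ≈⟨ ‖‖²-scale t x ⟩
      t * t * ‖ x ‖²       ≈⟨ *-congˡ (trans (sym s²≈‖x‖²) (sym (*-identityʳ _))) ⟩
      t * t * (s * s * 1#) ≈⟨ solve 3 (λ s t y →
        t :* t :* (s :* s :* y) := s :* s :* (t :* t :* y)) refl s t 1# ⟩
      s * s * (t * t * 1#) ≈⟨ s²t² 1# ⟩
      1#                   ∎

  σ‖x‖²≤‖Mx‖² : ∀ {m k} (M : Matrix m k) {σ} →
    LowerBound (λ y → ∃ λ x → ‖ x ‖² ≈ 1# × y ≈ ‖ M *ᵛ x ‖²) σ →
    ∀ x → σ * ‖ x ‖² ≤ ‖ M *ᵛ x ‖²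
  σ‖x‖²≤‖Mx‖² M {σ} lower x with ‖ x ‖² Order.≟ 0#
  ... | yes ‖x‖²≈0 = begin
    σ * ‖ x ‖²    ≈⟨ trans (*-congˡ ‖x‖²≈0) (zeroʳ σ) ⟩
    0#            ≤⟨ ‖‖²-nonneg (M *ᵛ x) ⟩
    ‖ M *ᵛ x ‖²   ∎
  ... | no ‖x‖²≉0 = σ‖x‖²≤‖Mx‖²-via-root M lower x
    (proj₂ (sqrt (‖‖²-nonneg x , λ 0≈ → ‖x‖²≉0 (sym 0≈)))) ‖x‖²≉0

  -- For k = 0 the squared norm is an empty sum, so there are no unit vectors, every real is a lower
  -- bound, and the greatest one would satisfy 1 + σ ≤ σ.
  σMin⇒0<k : ∀ {m k} {V : Matrix m k} {σ} → IsσMin V σ → 0# < fromℕ k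
  σMin⇒0<k {k = ℕ.suc k} _ = +-pos 0<1 (0≤fromℕ k)
  σMin⇒0<k {k = ℕ.zero} {σ = σ} (_ , _ , _ , greatest) =
    contradiction (Order.antisym (proj₁ 0<1) 1≤0) 0≉1
    where
    1≤0 : 1# ≤ 0#
    1≤0 = +-cancelʳ-≤ σ (begin
      1# + σ ≤⟨ greatest (1# + σ) (λ { _ (_ , 0≈1 , _) → contradiction 0≈1 0≉1 }) ⟩
      σ      ≈⟨ +-identityˡ σ ⟨
      0# + σ ∎)

-- From the gain of one round to a recurrence for the gap.

module GreedyProgress {c ℓ} (ℝ : Reals c ℓ) where
  open LinearAlgebra ℝ
  open OrderedField ℝ
  open Projections ℝ
  open ≤-Reasoning
  open Solver using (solve; _:=_; _:+_; _:*_; con)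
  open Algebra.Properties.Semiring.Sum semiring
  open Algebra.Properties.Semiring.Mult semiring using (×-homo-+; ×1-homo-*)

  sum-linear-≤ : ∀ {n} u v w {x y z : Vector Carrier n} →
    (∀ l → u * x l ≤ v * x l + w * y l + u * z l) →
    u * sum x ≤ v * sum x + w * sum y + u * sum z
  sum-linear-≤ u v w {x} {y} {z} bound = begin
    u * sum x
      ≈⟨ *-distribˡ-sum u x ⟩
    sum (λ l → u * x l)
      ≤⟨ sum-mono-≤ bound ⟩
    sum (λ l → v * x l + w * y l + u * z l)
      ≈⟨ ∑-distrib-+ (λ l → v * x l + w * y l) (λ l → u * z l) ⟩
    sum (λ l → v * x l + w * y l) + sum (λ l → u * z l)
      ≈⟨ +-congʳ (∑-distrib-+ (λ l → v * x l) (λ l → w * y l)) ⟩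
    sum (λ l → v * x l) + sum (λ l → w * y l) + sum (λ l → u * z l)
      ≈⟨ +-cong (+-cong (*-distribˡ-sum v x) (*-distribˡ-sum w y)) (*-distribˡ-sum u z) ⟨
    v * sum x + w * sum y + u * sum z ∎

  module Step {m n k k′} (A : Matrix m n) (W M : Matrix m k)
              (rescaling : ∀ j → IsUnitRescaling (column W j) (column M j))
              {σ} (0<σ : 0# < σ) (σ-bound : ∀ x → σ * ‖ x ‖² ≤ ‖ M *ᵛ x ‖²)
              (V : Matrix m k′) where
    open Normalised W M rescaling

    -- Entry j is the inner product of the unit vector `column M j` with the residual of a.
    correlation : Vector Carrier m → Vector Carrier k
    correlation a = M ᵀ *ᵛ residual V a

    -- With Π W a = M x, the adjoint turns the inner product with the residual into ⟨x , Mᵀ r⟩.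
    -- Young's inequality separates the factors, and `σ-bound` trades σ ‖x‖² for ‖Π W a‖².
    column-bound : ∀ {s t} → 0# ≤ s → 0# ≤ t → ∀ a →
      σ * (s * t) * ‖ Π W *ᵛ a ‖² ≤ s * s * ‖ Π W *ᵛ a ‖²
        + σ * (t * t) * ‖ correlation a ‖² + σ * (s * t) * ‖ Π V *ᵛ a ‖²
    column-bound {s} {t} 0≤s 0≤t a = begin
      σ * (s * t) * Q
        ≤⟨ *-monoˡ-≤ (*-nonneg (proj₁ 0<σ) (*-nonneg 0≤s 0≤t))
             (projection-deficit W V a) ⟩
      σ * (s * t) * (q · r + q · r + P)
        ≈⟨ *-congˡ (+-congʳ (+-cong q·r q·r)) ⟩
      σ * (s * t) * (x · g + x · g + P)
        ≈⟨ solve 4 (λ σ u y p → σ :* u :* (y :+ y :+ p) :=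
             σ :* (u :* y :+ u :* y) :+ σ :* u :* p) refl σ (s * t) (x · g) P ⟩
      σ * (s * t * x · g + s * t * x · g) + σ * (s * t) * P
        ≤⟨ +-monoˡ-≤ _ (*-monoˡ-≤ (proj₁ 0<σ) (young s t x g)) ⟩
      σ * (s * s * ‖ x ‖² + t * t * ‖ g ‖²) + σ * (s * t) * P
        ≈⟨ +-congʳ (solve 5 (λ σ u v y z → σ :* (u :* y :+ v :* z) :=
             u :* (σ :* y) :+ σ :* v :* z) refl σ (s * s) (t * t) ‖ x ‖² ‖ g ‖²) ⟩
      s * s * (σ * ‖ x ‖²) + σ * (t * t) * ‖ g ‖² + σ * (s * t) * P
        ≤⟨ +-monoˡ-≤ _ (+-monoˡ-≤ _ (*-monoˡ-≤ (0≤x² s) (σ-bound x))) ⟩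
      s * s * ‖ M *ᵛ x ‖² + σ * (t * t) * ‖ g ‖² + σ * (s * t) * P
        ≈⟨ +-congʳ (+-congʳ (*-congˡ (‖‖²-cong Mx≋q))) ⟩
      s * s * Q + σ * (t * t) * ‖ g ‖² + σ * (s * t) * P ∎
      where
      q r : Vector Carrier m
      q = Π W *ᵛ a
      r = residual V a
      g : Vector Carrier k
      g = correlation a
      P Q : Carrier
      P = ‖ Π V *ᵛ a ‖²
      Q = ‖ q ‖²
      q∈span : Span M q
      q∈span = span⊆ (Projector.range⊆span W a)
      x : Vector Carrier k
      x = proj₁ q∈span
      Mx≋q : ∀ i → (M *ᵛ x) i ≈ q i
      Mx≋q = proj₂ q∈span
      q·r : q · r ≈ x · g
      q·r = trans (·-congʳ r (λ i → sym (Mx≋q i))) (adjoint M x r)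

    total : Carrier
    total = sum (λ l → ‖ correlation (column A l) ‖²)

    total-nonneg : 0# ≤ total
    total-nonneg = sum-nonneg (λ l → ‖‖²-nonneg (correlation (column A l)))

    f-bound : ∀ {s t} → 0# ≤ s → 0# ≤ t →
      σ * (s * t) * f A W ≤
        s * s * f A W + σ * (t * t) * total + σ * (s * t) * f A V
    f-bound {s} {t} 0≤s 0≤t = begin
      σ * (s * t) * f A W
        ≈⟨ *-congˡ (f≈∑‖Πa‖² A W) ⟩
      σ * (s * t) * sum (λ l → ‖ Π W *ᵛ column A l ‖²)
        ≤⟨ sum-linear-≤ (σ * (s * t)) (s * s) (σ * (t * t))
             (λ l → column-bound 0≤s 0≤t (column A l)) ⟩
      s * s * sum (λ l → ‖ Π W *ᵛ column A l ‖²) + σ * (t * t) * total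
        + σ * (s * t) * sum (λ l → ‖ Π V *ᵛ column A l ‖²)
        ≈⟨ +-cong (+-congʳ (*-congˡ (f≈∑‖Πa‖² A W))) (*-congˡ (f≈∑‖Πa‖² A V)) ⟨
      s * s * f A W + σ * (t * t) * total + σ * (s * t) * f A V ∎

    -- f-bound at s = σ δ and t = 2 f A W.
    gap²≤total : ∀ {δ} → 0# ≤ δ → 0# < f A W → f A W ≈ f A V + δ →
                 σ * (δ * δ) ≤ fromℕ 4 * f A W * total
    gap²≤total {δ} 0≤δ 0<F F≈φ+δ = *-cancelˡ-≤ (*-pos 0<σ 0<F)
      -- Since F = φ + δ, the left side u F of `f-bound` is u φ + 2σ²δ²F. One copy of σ²δ²F and u φ
      -- cancel, leaving σ²δ²F ≤ 4σF² `total`, from which σF is cancelled.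
      (+-cancelʳ-≤ (σ * F * (σ * (δ * δ)) + u * φ) (begin
        σ * F * (σ * (δ * δ)) + (σ * F * (σ * (δ * δ)) + u * φ)
          ≈⟨ solve 4 (λ σ δ F φ →
               σ :* F :* (σ :* (δ :* δ)) :+ (σ :* F :* (σ :* (δ :* δ)) :+
                 σ :* (σ :* δ :* (F :+ F)) :* φ) :=
               σ :* (σ :* δ :* (F :+ F)) :* (φ :+ δ)) refl σ δ F φ ⟩
        u * (φ + δ)
          ≈⟨ *-congˡ F≈φ+δ ⟨
        u * F
          ≤⟨ f-bound (*-nonneg (proj₁ 0<σ) 0≤δ) (+-nonneg (proj₁ 0<F) (proj₁ 0<F)) ⟩
        σ * δ * (σ * δ) * F + σ * ((F + F) * (F + F)) * total + u * φ
          ≈⟨ solve 5 (λ σ δ F g w →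
               σ :* δ :* (σ :* δ) :* F :+ σ :* ((F :+ F) :* (F :+ F)) :* g :+ w :=
               -- The nested sum is the unfolding of `fromℕ 4`.
               σ :* F :* ((con 1 :+ (con 1 :+ (con 1 :+ (con 1 :+ con 0)))) :* F :* g)
               :+ (σ :* F :* (σ :* (δ :* δ)) :+ w))
               refl σ δ F total (u * φ) ⟩
        σ * F * (fromℕ 4 * F * total) + (σ * F * (σ * (δ * δ)) + u * φ) ∎))
      where
      F φ u : Carrier
      F = f A W
      φ = f A V
      u = σ * (σ * δ * (F + F))

    total≤k*gain : ∀ {g} →
      (∀ j → sum (λ l → correlation (column A l) j * correlation (column A l) j) ≤ g) →
      total ≤ fromℕ k * g
    total≤k*gain {g} bound = begin
      total
        ≈⟨ ∑-comm (λ l j → correlation (column A l) j * correlation (column A l) j) ⟩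
      sum (λ j → sum (λ l → correlation (column A l) j * correlation (column A l) j))
        ≤⟨ sum≤n*bound bound ⟩
      fromℕ k * g ∎

  -- The argument yields the constant 4, which is relaxed to the 16 of the theorem.
  4≤16 : fromℕ 4 ≤ fromℕ 16
  4≤16 = Order.≤-respʳ-≈ (sym (×-homo-+ 1# 4 12)) (x≤x+y _ (0≤fromℕ 12))

  -- With e = c − y the hypothesis reads c y′ ≤ y e.  If e ≥ 0 then
  -- c (1 + n) y′ ≤ y e + n y e ≤ y c + c e = c².
  recurrence : ∀ {c n y y′} → 0# < c → 0# ≤ n → y′ ≤ y →
    (0# ≤ y → y * y + c * y′ ≤ c * y) → n * y ≤ c → (1# + n) * y′ ≤ c
  recurrence {c} {n} {y} {y′} 0<c 0≤n y′≤y step ny≤c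
    with Order.total 0# y | Order.total 0# (c - y)
  ... | inj₂ y≤0 | _ = begin
    (1# + n) * y′ ≤⟨ *-monoˡ-≤ (+-nonneg (proj₁ 0<1) 0≤n) (Order.trans y′≤y y≤0) ⟩
    (1# + n) * 0# ≈⟨ zeroʳ _ ⟩
    0#            ≤⟨ proj₁ 0<c ⟩
    c             ∎
  ... | inj₁ 0≤y | e-sign = *-cancelˡ-≤ 0<c (begin
    c * ((1# + n) * y′)   ≈⟨ solve 3 (λ c n x → c :* (n :* x) := n :* (c :* x))
                               refl c (1# + n) y′ ⟩
    (1# + n) * (c * y′)   ≤⟨ *-monoˡ-≤ (+-nonneg (proj₁ 0<1) 0≤n) cy′≤ye ⟩
    (1# + n) * (y * e)    ≤⟨ bound e-sign ⟩
    c * c                 ∎)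
    where
    e : Carrier
    e = c - y

    y+e≈c : y + e ≈ c
    y+e≈c = x+[y-x]≈y y c

    cy′≤ye : c * y′ ≤ y * e
    cy′≤ye = +-cancelʳ-≤ (y * y) (begin
      c * y′ + y * y ≈⟨ +-comm _ _ ⟩
      y * y + c * y′ ≤⟨ step 0≤y ⟩
      c * y          ≈⟨ *-congʳ y+e≈c ⟨
      (y + e) * y    ≈⟨ solve 2 (λ y e → (y :+ e) :* y := y :* e :+ y :* y) refl y e ⟩
      y * e + y * y  ∎)

    bound : 0# ≤ e ⊎ e ≤ 0# → (1# + n) * (y * e) ≤ c * c
    -- This case can arise for n = 0, where `ny≤c` does not bound y by c. The left side is then at
    -- most 0.
    bound (inj₂ e≤0) = begin
      (1# + n) * (y * e)  ≤⟨ *-monoˡ-≤ (+-nonneg (proj₁ 0<1) 0≤n) (*-monoˡ-≤ 0≤y e≤0) ⟩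
      (1# + n) * (y * 0#) ≈⟨ trans (*-congˡ (zeroʳ y)) (zeroʳ _) ⟩
      0#                  ≤⟨ 0≤x² c ⟩
      c * c               ∎
    bound (inj₁ 0≤e) = begin
      (1# + n) * (y * e)    ≈⟨ solve 3 (λ n y e →
        (con 1 :+ n) :* (y :* e) := y :* e :+ n :* y :* e) refl n y e ⟩
      y * e + n * y * e     ≤⟨ +-mono-≤ (*-monoˡ-≤ 0≤y e≤c) (*-monoʳ-≤ 0≤e ny≤c) ⟩
      y * c + c * e         ≈⟨ solve 3 (λ y c e → y :* c :+ c :* e := c :* (y :+ e))
                                 refl y c e ⟩
      c * (y + e)           ≈⟨ *-congˡ y+e≈c ⟩
      c * c                 ∎
      where
      e≤c : e ≤ c
      e≤c = begin
        e     ≤⟨ x≤x+y e 0≤y ⟩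
        e + y ≈⟨ +-comm e y ⟩
        y + e ≈⟨ y+e≈c ⟩
        c     ∎

  -- The gap after all greedy rounds.

  module Bound {m nA nB} (A : Matrix m nA) (B : Matrix m nB) (OPT : Subset nB)
               {σ} (isσMin : IsσMin (B ↾ OPT) σ) (0<σ : 0# < σ)
               (0<F : 0# < f A (B ↾ OPT)) where
    F K : Carrier
    F = f A (B ↾ OPT)
    K = fromℕ (16 ℕ.* ∣ OPT ∣)

    gap : Subset nB → Carrier
    gap S = F - f A (B ↾ S)

    K≈16k : K ≈ fromℕ 16 * fromℕ ∣ OPT ∣
    K≈16k = ×1-homo-* 16 ∣ OPT ∣

    0<k : 0# < fromℕ ∣ OPT ∣
    0<k = σMin⇒0<k isσMin

    0<K : 0# < K
    0<K = 0<-≤-trans (*-pos (+-pos 0<1 (0≤fromℕ 15)) 0<k) (Order.reflexive (sym K≈16k))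

    0<KF : 0# < K * F
    0<KF = *-pos 0<K 0<F

    module Pick (S : Subset nB) (j : Fin nB)
      (greedy : ∀ j′ → f A (B ↾ (S ∪ ⁅ j′ ⁆)) ≤ f A (B ↾ (S ∪ ⁅ j ⁆))) where

      M : Matrix m ∣ OPT ∣
      M = proj₁ isσMin

      open Step A (B ↾ OPT) M (proj₁ (proj₂ isσMin)) 0<σ
        (σ‖x‖²≤‖Mx‖² M (proj₁ (proj₂ (proj₂ isσMin)))) (B ↾ S)

      φ φ′ g δ δ′ : Carrier
      φ  = f A (B ↾ S)
      φ′ = f A (B ↾ (S ∪ ⁅ j ⁆))
      g  = φ′ - φ
      δ  = gap S
      δ′ = gap (S ∪ ⁅ j ⁆)

      δ≈g+δ′ : δ ≈ g + δ′
      δ≈g+δ′ = +-cancelˡ φ _ _ (begin-equality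
        φ + δ        ≈⟨ x+[y-x]≈y φ F ⟩
        F            ≈⟨ x+[y-x]≈y φ′ F ⟨
        φ′ + δ′      ≈⟨ +-congʳ (x+[y-x]≈y φ φ′) ⟨
        φ + g + δ′   ≈⟨ +-assoc φ g δ′ ⟩
        φ + (g + δ′) ∎)

      -- The span of S with column `jᵢ` added contains the unit vector `column M i`, so `f-gain`
      -- bounds the gain of that choice from below, and the greedy choice gains at least as much.
      -- This includes the case that `jᵢ` is already in S.
      single-gain : ∀ i →
        sum (λ l → correlation (column A l) i * correlation (column A l) i) ≤ g
      single-gain i = +-cancelʳ-≤ φ (begin
        sum (λ l → correlation (column A l) i * correlation (column A l) i) + φ
          ≤⟨ f-gain (B ↾ S) (B ↾ S⁺)
               (λ l → fixes-selected B (p⊆p∪q ⁅ jᵢ ⁆ (enumerate-∈ S l)))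
               (IsUnitRescaling.unit (proj₁ (proj₂ isσMin) i))
               (Normalised.fixes-normalised (B ↾ OPT) M (proj₁ (proj₂ isσMin))
                 (Π (B ↾ S⁺)) i (fixes-selected B (q⊆p∪q S ⁅ jᵢ ⁆ (x∈⁅x⁆ jᵢ))))
               A ⟩
        f A (B ↾ S⁺)
          ≤⟨ greedy jᵢ ⟩
        φ′
          ≈⟨ x+[y-x]≈y φ φ′ ⟨
        φ + g
          ≈⟨ +-comm φ g ⟩
        g + φ ∎)
        where
        jᵢ : Fin nB
        jᵢ = enumerate OPT i
        S⁺ : Subset nB
        S⁺ = S ∪ ⁅ jᵢ ⁆

      total≤kg : total ≤ fromℕ ∣ OPT ∣ * g
      total≤kg = total≤k*gain single-gain

      -- Read off from 0 ≤ `total` ≤ k g and k > 0, without a separate monotonicity argument for f.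
      0≤g : 0# ≤ g
      0≤g = *-cancelˡ-0≤ 0<k (Order.trans total-nonneg total≤kg)

      progress : 0# ≤ δ → σ * (δ * δ) ≤ K * F * g
      progress 0≤δ = begin
        σ * (δ * δ)
          ≤⟨ gap²≤total 0≤δ 0<F (sym (x+[y-x]≈y φ F)) ⟩
        fromℕ 4 * F * total
          ≤⟨ *-mono-≤ (*-nonneg (0≤fromℕ 4) (proj₁ 0<F)) (*-nonneg (proj₁ 0<k) 0≤g)
               (*-monoʳ-≤ (proj₁ 0<F) 4≤16) total≤kg ⟩
        fromℕ 16 * F * (fromℕ ∣ OPT ∣ * g)
          ≈⟨ solve 4 (λ a F k g → a :* F :* (k :* g) := a :* k :* F :* g)
               refl (fromℕ 16) F (fromℕ ∣ OPT ∣) g ⟩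
        fromℕ 16 * fromℕ ∣ OPT ∣ * F * g
          ≈⟨ *-congʳ (*-congʳ K≈16k) ⟨
        K * F * g ∎

      σδ′≤σδ : σ * δ′ ≤ σ * δ
      σδ′≤σδ = *-monoˡ-≤ (proj₁ 0<σ) (begin
        δ′     ≤⟨ x≤x+y δ′ 0≤g ⟩
        δ′ + g ≈⟨ +-comm δ′ g ⟩
        g + δ′ ≈⟨ δ≈g+δ′ ⟨
        δ      ∎)

      -- Multiplying `progress` by σ and using g = δ - δ′ gives the hypothesis of `recurrence` for y
      -- = σδ, y′ = σδ′ and c = KF.
      scaled-progress : 0# ≤ σ * δ →
        σ * δ * (σ * δ) + K * F * (σ * δ′) ≤ K * F * (σ * δ)
      scaled-progress 0≤σδ = begin
        σ * δ * (σ * δ) + K * F * (σ * δ′)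
          ≈⟨ +-congʳ (solve 2 (λ σ δ → σ :* δ :* (σ :* δ) := σ :* (σ :* (δ :* δ)))
               refl σ δ) ⟩
        σ * (σ * (δ * δ)) + K * F * (σ * δ′)
          ≤⟨ +-monoˡ-≤ _ (*-monoˡ-≤ (proj₁ 0<σ) (progress (*-cancelˡ-0≤ 0<σ 0≤σδ))) ⟩
        σ * (K * F * g) + K * F * (σ * δ′)
          ≈⟨ solve 4 (λ σ c g d → σ :* (c :* g) :+ c :* (σ :* d) :=
               c :* (σ :* (g :+ d))) refl σ (K * F) g δ′ ⟩
        K * F * (σ * (g + δ′))
          ≈⟨ *-congˡ (*-congˡ δ≈g+δ′) ⟨
        K * F * (σ * δ) ∎

    -- The division-free form of δᵢ ≤ KF / (iσ), which makes sense for i = 0 and so starts the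
    -- induction.
    greedy-gap : ∀ {i S} → Greedy A B i S → fromℕ i * (σ * gap S) ≤ K * F
    greedy-gap start = Order.≤-respˡ-≈ (sym (zeroˡ _)) (proj₁ 0<KF)
    greedy-gap (pick {i} {S} run j greedy) =
      recurrence 0<KF (0≤fromℕ i) σδ′≤σδ scaled-progress (greedy-gap run)
      where open Pick S j greedy

    gap≤εF : ∀ {ε} → 0# < ε → ∀ {r} → K / (ε * σ) ≤ fromℕ r →
             ∀ {T} → Greedy A B r T → gap T ≤ ε * F
    gap≤εF {ε} 0<ε {r} K/εσ≤r {T} run with Order.total 0# (gap T)
    -- The greedy set may have more than `∣ OPT ∣` columns and overshoot F. Multiplying the bound on
    -- r by the gap needs a nonnegative gap.
    ... | inj₂ gap≤0 = Order.trans gap≤0 (*-nonneg (proj₁ 0<ε) (proj₁ 0<F))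
    ... | inj₁ 0≤gap = *-cancelˡ-≤ 0<K (begin
      K * gap T
        ≈⟨ *-congʳ (x/y*y≈x K (0<⇒≉0 0<εσ)) ⟨
      K / (ε * σ) * (ε * σ) * gap T
        ≤⟨ *-monoʳ-≤ 0≤gap (*-monoʳ-≤ (proj₁ 0<εσ) K/εσ≤r) ⟩
      fromℕ r * (ε * σ) * gap T
        ≈⟨ solve 4 (λ r ε σ d → r :* (ε :* σ) :* d := ε :* (r :* (σ :* d)))
             refl (fromℕ r) ε σ (gap T) ⟩
      ε * (fromℕ r * (σ * gap T))
        ≤⟨ *-monoˡ-≤ (proj₁ 0<ε) (greedy-gap run) ⟩
      ε * (K * F)
        ≈⟨ solve 3 (λ ε K F → ε :* (K :* F) := K :* (ε :* F)) refl ε K F ⟩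
      K * (ε * F) ∎)
      where
      0<εσ : 0# < ε * σ
      0<εσ = *-pos 0<ε 0<σ

theorem1 : ∀ {c ℓ} (ℝ : Reals c ℓ) → let open LinearAlgebra ℝ in
    ∀ (m nA nB : ℕ) (A : Matrix m nA) (B : Matrix m nB) →
    (∀ j → NonZero (column B j)) →
    ∀ (k : ℕ) → k ℕ.≤ nB →
    ∀ (OPT : Subset nB) → IsOptimal A B k OPT →
    ∀ (σ : Carrier) → IsσMin (B ↾ OPT) σ → 0# < σ →
    ∀ (ε : Carrier) → 0# < ε →
    ∀ (r : ℕ) → IsCeiling (fromℕ (16 ℕ.* k) / (ε * σ)) r →
    ∀ (T : Subset nB) → Greedy A B r T →
    (1# - ε) * f A (B ↾ OPT) ≤ f A (B ↾ T)
-- Matching on `size` identifies k with `∣ OPT ∣`, the number of columns of `B ↾ OPT`.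
theorem1 ℝ m nA nB A B _ k _ OPT record { size = ≡.refl }
         σ isσMin 0<σ ε 0<ε r (K/εσ≤r , _) T run = bound
  where
  open LinearAlgebra ℝ
  open OrderedField ℝ
  open Projections ℝ using (f-nonneg)
  open ≤-Reasoning

  F : Carrier
  F = f A (B ↾ OPT)

  bound : (1# - ε) * F ≤ f A (B ↾ T)
  bound with F Order.≟ 0#
  -- The gap estimate cancels a factor F, so F = 0 is treated apart; the left side is then 0.
  ... | yes F≈0 = Order.≤-respˡ-≈ (sym (trans (*-congˡ F≈0) (zeroʳ _)))
                    (f-nonneg A (B ↾ T))
  ... | no F≉0 = +-cancelʳ-≤ (ε * F) (begin
    (1# - ε) * F + ε * F   ≈⟨ distribʳ F (1# - ε) ε ⟨
    (1# - ε + ε) * F       ≈⟨ *-congʳ (trans (+-comm _ ε) (x+[y-x]≈y ε 1#)) ⟩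
    1# * F                 ≈⟨ *-identityˡ F ⟩
    F                      ≈⟨ x+[y-x]≈y (f A (B ↾ T)) F ⟨
    f A (B ↾ T) + gap T    ≤⟨ +-mono-≤ Order.refl (gap≤εF 0<ε K/εσ≤r run) ⟩
    f A (B ↾ T) + ε * F    ∎)
    where
    open GreedyProgress ℝ
    open Bound A B OPT isσMin 0<σ (f-nonneg A (B ↾ OPT) , λ 0≈F → F≉0 (sym 0≈F))
      using (gap; gap≤εF)
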